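{- For any $n$ and $k$, the statistics $\mathsf{exc}$ and $\mathsf{des}$ are equidistributed on the elements of $\mathsf A_n^k$ in their permutation form, and, respectively, the statistics $\mathsf{inv}$ and $\mathsf{maj}$ are equidistributed on the elements of $\mathsf A_n^k$ in their permutation form.
   Context: $[n]=\{1,\dots,n\}$. For $n\ge1$ and $k\ge1$, a $k$-arrangement of $[n]$ is a pair $(\pi,\phi)$ where $\pi$ is a permutation of $[n]$ and $\phi:\mathsf{Fix}(\pi)\to[k]$ is an arbitrary map on the set $\mathsf{Fix}(\pi)$ of fixed points of $\pi$. A $0$-arrangement of $[n]$ is a derangement of $[n]$ (a permutation without fixed points). For any integer $k\ge0$, the set of $k$-arrangements of $[n]$ is denoted $\mathsf A_n^k$, and $\mathsf A_0^k$ consists of the empty word. The permutation form of an element of $\mathsf A_n^k$ is a word of length $n$ on the alphabet $\{ -k+1,\dots,-1,1,2,\dots,n-K\}$, where $K$ is the number of negative letters in the word, and the positive letters appear once each, forming a permutation of $[n-K]$. It is obtained from $(\pi,\phi)$, with $\pi=a_1a_2\ldots a_n$, by replacing $a_i$ by $-\phi(i)$ for each fixed point $i$ of $\pi$ with $\phi(i)\ne k$ (fixed points $i$ with $\phi(i)=k$ are left intact), and then replacing the $j$-th smallest of the remaining positive letters by $j$, for each $j$. For a word $\mathfrak a=a_1\ldots a_n$ of integers, let $s_1\ldots s_n$ be the word consisting of its letters sorted in weakly increasing order. Then $\mathsf{exc}(\mathfrak a)=\#\{i: a_i>s_i\}$; a descent of $\mathfrak a$ is an $i\in[n-1]$ with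 $a_i>a_{i+1}$; $\mathsf{des}(\mathfrak a)$ is the number of descents, and $\mathsf{maj}(\mathfrak a)$ is the sum of the descents; $\mathsf{inv}(\mathfrak a)=\#\{(i,j): i<j,\ a_i>a_j\}$. Two statistics are equidistributed on a finite set if, for each value $v$, they take the value $v$ the same number of times on that set.
   Formalization: The theorem is stated for k ≥ 1 only; for k = 0 (derangements as their own permutation form) the claim is false: for n = 3 the words 231, 312 have exc = 2, 1 but des = 1, 1, and inv = 2, 2 but maj = 2, 1. -}

module Defs where

open import Axiom.UniquenessOfIdentityProofs using (module Decidable⇒UIP)
open import Data.Bool using (if_then_else_)
open import Data.Fin using (Fin; toℕ; _≟_)
open import Data.Fin.Permutation using (Permutation′; _⟨$⟩ʳ_; _≈_)
open import Data.Integer using (ℤ; +_; -_; 0ℤ; _≤?_; _<?_)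
open import Data.Integer.Properties using (≤-decTotalOrder)
open import Data.List using (List; []; _∷_; length; filter; map; tabulate; zip)
open import Data.List.Properties using (tabulate-cong)
open import Data.List.Sort ≤-decTotalOrder using (sort)
open import Data.Nat using (ℕ; suc; _+_)
import Data.Nat as ℕ
open import Data.Nat.ListAction using (sum)
open import Data.Product using (∃; _×_; _,_; proj₁)
open import Function using (Func; Inverse; _∘_)
open import Level using (0ℓ)
open import Relation.Binary using (Setoid)
import Relation.Binary.Construct.On as On
open import Relation.Binary.PropositionalEquality
  using (_≡_; refl; sym; trans; cong; setoid)
open import Relation.Nullary using (does; yes; no; contradiction)
open import Relation.Nullary.Decidable using (_×-dec_)

Fix : ∀ {n} → Permutation′ n → Set
Fix π = ∃ λ i → π ⟨$⟩ʳ i ≡ i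

-- The element i of Fin n stands for the element suc (toℕ i) of [n], and
-- likewise for the colours in Fin k.  For k = 0 the map φ exists only if
-- π has no fixed points, so these are the derangements.
record Arrangement (n k : ℕ) : Set where
  constructor _,_
  field
    π : Permutation′ n
    φ : Fix π → Fin k

open Arrangement public

infix 4 _≋_

-- Pointwise equality of both components (functions, so ≡ would be too fine).
record _≋_ {n k : ℕ} (A B : Arrangement n k) : Set where
  constructor _,_
  field
    π-≈ : π A ≈ π B
    φ-≈ : ∀ (x : Fix (π A)) (y : Fix (π B)) → proj₁ x ≡ proj₁ y → φ A x ≡ φ B y

≋-refl : ∀ {n k} {A : Arrangement n k} → A ≋ A
≋-refl {A = A} = (λ _ → refl) , λ where
  (i , p) (.i , q) refl →
    cong (λ r → φ A (i , r)) (Decidable⇒UIP.≡-irrelevant _≟_ p q)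

≋-sym : ∀ {n k} {A B : Arrangement n k} → A ≋ B → B ≋ A
≋-sym (p , q) = (λ i → sym (p i)) , λ x y e → sym (q y x (sym e))

≋-trans : ∀ {n k} {A B C : Arrangement n k} → A ≋ B → B ≋ C → A ≋ C
≋-trans (p , q) (p′ , q′) =
  (λ i → trans (p i) (p′ i)) ,
  λ (i , a) y e →
    let b = i , trans (sym (p i)) a
    in trans (q (i , a) b refl) (q′ b y e)

𝖠 : (n k : ℕ) → Setoid 0ℓ 0ℓ
𝖠 n k = record
  { Carrier       = Arrangement n k
  ; _≈_           = _≋_
  ; isEquivalence = record { refl = ≋-refl ; sym = ≋-sym ; trans = ≋-trans }
  }

fixedLetter : ∀ {n k} → Fin n → Fin k → ℤ
fixedLetter {k = k} i c with suc (toℕ c) ℕ.≟ k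
... | yes _ = + suc (toℕ i)
... | no  _ = - (+ suc (toℕ c))

letter : ∀ {n k} → Arrangement n k → Fin n → ℤ
letter A i with π A ⟨$⟩ʳ i ≟ i
... | yes p = fixedLetter i (φ A (i , p))
... | no  _ = + suc (toℕ (π A ⟨$⟩ʳ i))

-- The j-th smallest positive letter x is the one for which exactly j
-- positive letters are ≤ x (the positive letters being distinct).
relabel : List ℤ → ℤ → ℤ
relabel w x with 0ℤ <? x
... | yes _ = + length (filter (λ y → (0ℤ <? y) ×-dec (y ≤? x)) w)
... | no  _ = x

standardise : List ℤ → List ℤ
standardise w = map (relabel w) w

permForm : ∀ {n k} → Arrangement n k → List ℤ
permForm A = standardise (tabulate (letter A))

letter-cong : ∀ {n k} {A B : Arrangement n k} → A ≋ B → ∀ i → letter A i ≡ letter B i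
letter-cong {A = A} {B} (p , q) i with π A ⟨$⟩ʳ i ≟ i | π B ⟨$⟩ʳ i ≟ i
... | yes a | yes b = cong (fixedLetter i) (q (i , a) (i , b) refl)
... | yes a | no ¬b = contradiction (trans (sym (p i)) a) ¬b
... | no ¬a | yes b = contradiction (trans (p i) b) ¬a
... | no _  | no _  = cong (λ j → + suc (toℕ j)) (p i)

permForm-cong : ∀ {n k} {A B : Arrangement n k} → A ≋ B → permForm A ≡ permForm B
permForm-cong e = cong standardise (tabulate-cong (letter-cong e))

exc : List ℤ → ℕ
exc w = length (filter (λ (a , s) → s <? a) (zip w (sort w)))

-- Positions are counted from 1.
descents : List ℤ → List ℕ
descents []          = []
descents (_ ∷ [])    = []
descents (x ∷ y ∷ w) = if does (y <? x)
  then 1 ∷ map suc (descents (y ∷ w))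
  else map suc (descents (y ∷ w))

des : List ℤ → ℕ
des w = length (descents w)

maj : List ℤ → ℕ
maj w = sum (descents w)

inv : List ℤ → ℕ
inv []      = 0
inv (x ∷ w) = length (filter (_<? x) w) + inv w

onPermForm : (List ℤ → ℕ) → ∀ n k → Func (𝖠 n k) (setoid ℕ)
onPermForm f n k = record
  { to   = f ∘ permForm
  ; cong = cong f ∘ permForm-cong
  }

Fibre : (S : Setoid 0ℓ 0ℓ) → Func S (setoid ℕ) → ℕ → Setoid 0ℓ 0ℓ
Fibre S f v = On.setoid S (proj₁ {B = λ a → Func.to f a ≡ v})

HasCardinality : Setoid 0ℓ 0ℓ → ℕ → Set
HasCardinality S m = Inverse S (setoid (Fin m))

Equidistributed : (S : Setoid 0ℓ 0ℓ) → (f g : Func S (setoid ℕ)) → Set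
Equidistributed S f g =
  ∀ v → ∃ λ m → HasCardinality (Fibre S f v) m × HasCardinality (Fibre S g v) m

{-# OPTIONS --safe #-}

-- The permutation forms of the k-arrangements of [n] are, for k ≥ 1, all words of
-- length n over the given alphabet whose positive letters form a permutation, so
-- they make up entire rearrangement classes of words.  On such a class Foata's two
-- fundamental transformations are bijections carrying des to exc and maj to inv;
-- as the classes are finite, it suffices that the transformations are injective.
--
-- Both are recursive in the last letter, so they are defined on reversed words.
-- The first one usually goes through the factorisation of a word at its
-- left-to-right maxima into cycles, giving an array of two rows that is then
-- sorted stably by its top row.  In the reversed word u₁ u₂ …, the letter on top
-- of uᵢ₊₁ is min (uᵢ , max (uᵢ₊₁ , uᵢ₊₂ , …)), so no factorisation is needed.

module Submission where

open import Defs
open import Axiom.UniquenessOfIdentityProofs using (module Decidable⇒UIP)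
open import Data.Bool using (true; false; if_then_else_)
open import Data.Fin using (Fin; toℕ; fromℕ<)
import Data.Fin as Fin
open import Data.Fin.Permutation
  using (Permutation′; permutation; _⟨$⟩ʳ_; _⟨$⟩ˡ_; inverseˡ)
import Data.Fin.Properties as Finₚ
open import Data.Integer
  using (ℤ; +_; -[1+_]; -_; 0ℤ; 1ℤ; _≤_; _<_; _<?_; _≤?_; _≟_; _⊔_; _⊓_; +<+; +≤+)
import Data.Integer.Properties as ℤₚ
open import Data.List
  using (List; []; _∷_; [_]; _++_; _∷ʳ_; length; filter; map; reverse; zip; tabulate; lookup;
         allFin; upTo; cartesianProductWith; deduplicate)
open import Data.List.Membership.Propositional using (_∈_)
import Data.List.Membership.Propositional.Properties as ∈ₚ
import Data.List.Properties as Listₚ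
open import Data.List.Relation.Binary.Permutation.Propositional
  using (_↭_; ↭-refl; ↭-sym; ↭-trans; ↭-reflexive; prep; swap; ↭⇒↭ₛ;
         module PermutationReasoning)
import Data.List.Relation.Binary.Permutation.Propositional.Properties as ↭ₚ
import Data.List.Relation.Binary.Permutation.Setoid.Properties as ↭ₛₚ
import Data.List.Relation.Binary.Pointwise as Pointwise
open import Data.List.Relation.Unary.All using (All; []; _∷_)
import Data.List.Relation.Unary.All as All
import Data.List.Relation.Unary.All.Properties as Allₚ
open import Data.List.Relation.Unary.AllPairs using (AllPairs; []; _∷_; allPairs?)
import Data.List.Relation.Unary.AllPairs.Properties as AllPairsₚ
open import Data.List.Relation.Unary.Any using (here; there; index)
import Data.List.Relation.Unary.Any.Properties as Anyₚ
import Data.List.Relation.Unary.Linked.Properties as Linkedₚ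
open import Data.List.Relation.Unary.Sorted.TotalOrder ℤₚ.≤-totalOrder using (Sorted)
import Data.List.Relation.Unary.Sorted.TotalOrder.Properties as Sortedₚ
import Data.List.Relation.Unary.Unique.DecPropositional.Properties as DecUniqueₚ
open import Data.List.Relation.Unary.Unique.Propositional using (Unique)
import Data.List.Relation.Unary.Unique.Propositional.Properties as Uniqueₚ
open import Data.List.Sort ℤₚ.≤-decTotalOrder using (sort; sort-↭; sort-↗)
open import Data.List.Sort.Base using (module SortingAlgorithm)
import Data.List.Sort.InsertionSort as InsertionSort
open import Data.Nat using (ℕ; zero; suc; _+_; _*_; _≥_; z≤n; s≤s)
import Data.Nat as ℕ
import Data.Nat.ListAction.Properties as Sumₚ
import Data.Nat.Properties as ℕₚ
open import Data.Nat.Tactic.RingSolver using (solve-∀)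
open import Data.Product using (∃; ∃₂; _×_; _,_; proj₁; proj₂)
import Data.Product as Product
open import Data.Sum using (_⊎_; inj₁; inj₂)
open import Function using (_∘_)
open import Level using (0ℓ)
open import Relation.Binary using (DecTotalOrder; DecidableEquality; Symmetric)
import Relation.Binary.Construct.On as On
open import Relation.Binary.PropositionalEquality
  using (_≡_; _≢_; refl; sym; trans; cong; cong₂; subst; ≢-sym; resp₂; setoid;
         module ≡-Reasoning)
open import Relation.Nullary using (Dec; does; yes; no; ¬_; contradiction; ¬?)
open import Relation.Nullary.Decidable
  using (_×-dec_; _→-dec_; dec-true; dec-false; decidable-stable)
open import Relation.Unary using (Pred; Decidable)

-- Indicators and counting.

𝟙 : {B : Set} → Dec B → ℕ
𝟙 d = if does d then 1 else 0

𝟙-yes : {B : Set} (d : Dec B) → B → 𝟙 d ≡ 1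
𝟙-yes d b rewrite dec-true d b = refl

𝟙-no : {B : Set} (d : Dec B) → ¬ B → 𝟙 d ≡ 0
𝟙-no d ¬b rewrite dec-false d ¬b = refl

module _ {A : Set} {P : Pred A 0ℓ} (P? : Decidable P) where

  count : List A → ℕ
  count xs = length (filter P? xs)

  count-∷ : (x : A) (xs : List A) →
    count (x ∷ xs) ≡ 𝟙 (P? x) + count xs
  count-∷ x xs with does (P? x)
  ... | true  = refl
  ... | false = refl

  count-↭ : {xs ys : List A} → xs ↭ ys → count xs ≡ count ys
  count-↭ p = ↭ₚ.↭-length (↭ₚ.filter-↭ P? p)

  count-complement : (xs : List A) →
    count xs + length (filter (¬? ∘ P?) xs) ≡ length xs
  count-complement []       = refl
  count-complement (x ∷ xs) with does (P? x)
  ... | true  = cong suc (count-complement xs)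
  ... | false = trans (ℕₚ.+-suc _ _) (cong suc (count-complement xs))

-- Descents and inversions of reversed words.

descents-∷ʳ : ∀ w y x →
  descents ((w ∷ʳ y) ∷ʳ x) ≡
  descents (w ∷ʳ y) ++ (if does (x <? y) then [ suc (length w) ] else [])
descents-∷ʳ [] y x with does (x <? y)
... | true  = refl
... | false = refl
descents-∷ʳ (z ∷ []) y x
  with does (y <? z) | does (x <? y)
... | true  | true  = refl
... | true  | false = refl
... | false | true  = refl
... | false | false = refl
descents-∷ʳ (z ∷ w@(z′ ∷ w′)) y x
  rewrite descents-∷ʳ w y x
        | Listₚ.map-++ suc (descents (w ∷ʳ y))
            (if does (x <? y) then [ suc (length w) ] else [])
  with does (z′ <? z) | does (x <? y)
... | true  | true  = refl
... | true  | false = refl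
... | false | true  = refl
... | false | false = refl

reverse-∷∷ : ∀ {A : Set} (x y : A) xs → reverse (x ∷ y ∷ xs) ≡ (reverse xs ∷ʳ y) ∷ʳ x
reverse-∷∷ x y xs =
  trans (Listₚ.unfold-reverse x (y ∷ xs)) (cong (_∷ʳ x) (Listₚ.unfold-reverse y xs))

-- Counted from 1, `y` stands at position `suc (length u)` of the reversed word, and this is the
-- only descent that `x`, coming last, can add.
descents-reverse-∷∷ : ∀ x y u →
  descents (reverse (x ∷ y ∷ u)) ≡
  descents (reverse (y ∷ u)) ++ (if does (x <? y) then [ suc (length u) ] else [])
descents-reverse-∷∷ x y u
  rewrite reverse-∷∷ x y u | Listₚ.unfold-reverse y u
        | descents-∷ʳ (reverse u) y x | Listₚ.length-reverse u = refl

des-reverse-∷∷ : ∀ x y u →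
  des (reverse (x ∷ y ∷ u)) ≡ 𝟙 (x <? y) + des (reverse (y ∷ u))
des-reverse-∷∷ x y u
  rewrite descents-reverse-∷∷ x y u
        | Listₚ.length-++ (descents (reverse (y ∷ u)))
            {if does (x <? y) then [ suc (length u) ] else []}
  with does (x <? y)
... | true  = ℕₚ.+-comm _ 1
... | false = ℕₚ.+-identityʳ _

maj-reverse-∷∷ : ∀ x y u →
  maj (reverse (x ∷ y ∷ u)) ≡ 𝟙 (x <? y) * suc (length u) + maj (reverse (y ∷ u))
maj-reverse-∷∷ x y u
  rewrite descents-reverse-∷∷ x y u
        | Sumₚ.sum-++ (descents (reverse (y ∷ u)))
            (if does (x <? y) then [ suc (length u) ] else [])
  with does (x <? y)
... | true  = ℕₚ.+-comm (maj (reverse (y ∷ u))) _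
... | false = ℕₚ.+-identityʳ _

inv-∷ʳ : ∀ w x → inv (w ∷ʳ x) ≡ inv w + count (x <?_) w
inv-∷ʳ []      x = refl
inv-∷ʳ (y ∷ w) x
  rewrite inv-∷ʳ w x
        | count-↭ (_<? y) (↭-sym (↭ₚ.∷↭∷ʳ x w))
        | count-∷ (_<? y) x w
        | count-∷ (x <?_) y w
  = arith (𝟙 (x <? y)) (count (_<? y) w) (inv w) (count (x <?_) w)
  where
  arith : ∀ a b c d → (a + b) + (c + d) ≡ (b + c) + (a + d)
  arith = solve-∀

inv-reverse-∷ : ∀ x u → inv (reverse (x ∷ u)) ≡ inv (reverse u) + count (x <?_) u
inv-reverse-∷ x u
  rewrite Listₚ.unfold-reverse x u
        | inv-∷ʳ (reverse u) x
        | count-↭ (x <?_) (↭ₚ.↭-reverse u) = refl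

-- Foata's second fundamental transformation

module _ {P : Pred ℤ 0ℓ} (P? : Decidable P) where

  -- Splits p ∷ ys before each letter satisfying P and moves that letter to the end
  -- of its block.
  rotate : ℤ → List ℤ → List ℤ
  rotate p []       = [ p ]
  rotate p (y ∷ ys) = if does (P? y) then p ∷ rotate y ys else y ∷ rotate p ys

  rotate-↭ : ∀ p ys → rotate p ys ↭ p ∷ ys
  rotate-↭ p []       = ↭-refl
  rotate-↭ p (y ∷ ys) with does (P? y)
  ... | true  = prep p (rotate-↭ y ys)
  ... | false = ↭-trans (prep y (rotate-↭ p ys)) (swap y p ↭-refl)

  rotate≢[] : ∀ p ys → rotate p ys ≢ []
  rotate≢[] p ys eq with ↭ₚ.↭-empty-inv (↭-sym (subst (_↭ p ∷ ys) eq (rotate-↭ p ys)))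
  ... | ()

  -- Reading the output from the left undoes the rotation: a head satisfying `P` is the opening
  -- letter of a block that ends there, a head violating `P` is a letter past which the pending
  -- opening letter was moved.
  rotate-injective : ∀ {p q} → P p → P q → ∀ ys zs →
    rotate p ys ≡ rotate q zs → p ∷ ys ≡ q ∷ zs
  rotate-injective Pp Pq []       []       refl = refl
  rotate-injective Pp Pq []       (z ∷ zs) eq with P? z
  ... | yes Pz = contradiction (sym (Listₚ.∷-injectiveʳ eq)) (rotate≢[] z zs)
  ... | no ¬Pz = contradiction (sym (Listₚ.∷-injectiveʳ eq)) (rotate≢[] _ zs)
  rotate-injective Pp Pq (y ∷ ys) []       eq with P? y
  ... | yes Py = contradiction (Listₚ.∷-injectiveʳ eq) (rotate≢[] y ys)
  ... | no ¬Py = contradiction (Listₚ.∷-injectiveʳ eq) (rotate≢[] _ ys)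
  rotate-injective Pp Pq (y ∷ ys) (z ∷ zs) eq with P? y | P? z
  ... | yes Py | yes Pz =
    cong₂ _∷_ (Listₚ.∷-injectiveˡ eq) (rotate-injective Py Pz ys zs (Listₚ.∷-injectiveʳ eq))
  ... | yes Py | no ¬Pz = contradiction (subst P (Listₚ.∷-injectiveˡ eq) Pp) ¬Pz
  ... | no ¬Py | yes Pz = contradiction (subst P (sym (Listₚ.∷-injectiveˡ eq)) Pq) ¬Py
  ... | no ¬Py | no ¬Pz
    with refl ← Listₚ.∷-injectiveˡ eq
    with refl ← rotate-injective Pp Pq ys zs (Listₚ.∷-injectiveʳ eq) = refl

  -- Each letter violating P is passed by exactly one letter satisfying P, which
  -- turns an amount a of inversions into b; written without subtraction.
  inv-rotate : ∀ {a b} →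
    (∀ {p y} → P p → ¬ P y → 𝟙 (p <? y) ≡ a × 𝟙 (y <? p) ≡ b) →
    ∀ {p} → P p → ∀ ys →
    inv (reverse (rotate p ys)) + a * count (¬? ∘ P?) ys ≡
    inv (reverse (p ∷ ys)) + b * count (¬? ∘ P?) ys
  inv-rotate {a} {b} cross {p} Pp [] =
    cong (λ j → inv (reverse [ p ]) + j) (trans (ℕₚ.*-zeroʳ a) (sym (ℕₚ.*-zeroʳ b)))
  inv-rotate {a} {b} cross {p} Pp (y ∷ ys) with P? y
  ... | yes Py
    rewrite inv-reverse-∷ p (rotate y ys)
          | count-↭ (p <?_) (rotate-↭ y ys)
          | inv-reverse-∷ p (y ∷ ys) =
    begin
      (I + c) + a * n  ≡⟨ swapʳ I c (a * n) ⟩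
      (I + a * n) + c  ≡⟨ cong (_+ c) (inv-rotate cross Py ys) ⟩
      (J + b * n) + c  ≡⟨ swapʳ J (b * n) c ⟩
      (J + c) + b * n  ∎
    where
    open ≡-Reasoning
    I = inv (reverse (rotate y ys))
    J = inv (reverse (y ∷ ys))
    c = count (p <?_) (y ∷ ys)
    n = count (¬? ∘ P?) ys
    swapʳ : ∀ i j k → (i + j) + k ≡ (i + k) + j
    swapʳ = solve-∀
  ... | no ¬Py
    rewrite inv-reverse-∷ y (rotate p ys)
          | count-↭ (y <?_) (rotate-↭ p ys)
          | count-∷ (y <?_) p ys
          | inv-reverse-∷ p (y ∷ ys)
          | count-∷ (p <?_) y ys
          | proj₁ (cross Pp ¬Py)
          | proj₂ (cross Pp ¬Py)
          | inv-reverse-∷ y ys =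
    begin
      (I + (b + c)) + a * suc n        ≡⟨ arith₁ a b c n I ⟩
      (I + a * n) + (a + b + c)        ≡⟨ cong (_+ (a + b + c)) (inv-rotate cross Pp ys) ⟩
      (inv (reverse (p ∷ ys)) + b * n) + (a + b + c)
        ≡⟨ cong (λ j → (j + b * n) + (a + b + c)) (inv-reverse-∷ p ys) ⟩
      ((J + d) + b * n) + (a + b + c)  ≡⟨ arith₂ a b c d n J ⟩
      ((J + c) + (a + d)) + b * suc n  ∎
    where
    open ≡-Reasoning
    I = inv (reverse (rotate p ys))
    J = inv (reverse ys)
    c = count (y <?_) ys
    d = count (p <?_) ys
    n = count (¬? ∘ P?) ys
    arith₁ : ∀ a b c n I → (I + (b + c)) + a * suc n ≡ (I + a * n) + (a + b + c)
    arith₁ = solve-∀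
    arith₂ : ∀ a b c d n J →
      ((J + d) + b * n) + (a + b + c) ≡ ((J + c) + (a + d)) + b * suc n
    arith₂ = solve-∀

  -- The last block ends in its rotated letter. Hence the last letter of the output betrays which of
  -- two complementary predicates was used, and with it the branch taken by `γ`.
  rotate-last : ∀ {p} → P p → ∀ ys → ∃₂ λ zs q → P q × rotate p ys ≡ zs ∷ʳ q
  rotate-last Pp []       = [] , _ , Pp , refl
  rotate-last Pp (y ∷ ys) with P? y
  ... | yes Py = let zs , q , Pq , eq = rotate-last Py ys in _ ∷ zs , q , Pq , cong (_ ∷_) eq
  ... | no ¬Py = let zs , q , Pq , eq = rotate-last Pp ys in y ∷ zs , q , Pq , cong (y ∷_) eq

-- The predicate is whichever of `x <_` and its negation holds of the first letter, so that `p`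
-- opens a block and the rotation lemmas apply.
γ : ℤ → List ℤ → List ℤ
γ x []       = []
γ x (p ∷ ys) = if does (x <? p) then rotate (x <?_) p ys else rotate (¬? ∘ (x <?_)) p ys

γ-↭ : ∀ x ys → γ x ys ↭ ys
γ-↭ x []       = ↭-refl
γ-↭ x (p ∷ ys) with does (x <? p)
... | true  = rotate-↭ (x <?_) p ys
... | false = rotate-↭ (¬? ∘ (x <?_)) p ys

rotations-differ : ∀ {x p q} → x < p → ¬ x < q → ∀ ys zs →
  rotate (x <?_) p ys ≢ rotate (¬? ∘ (x <?_)) q zs
rotations-differ x<p x≮q ys zs eq
  with _ , _ , Pp , eq₁ ← rotate-last (_ <?_) x<p ys
     | _ , _ , Pq , eq₂ ← rotate-last (¬? ∘ (_ <?_)) x≮q zs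
  = Pq (subst (_ <_) (Listₚ.∷ʳ-injectiveʳ _ _ (trans (sym eq₁) (trans eq eq₂))) Pp)

γ-injective : ∀ x ys zs → γ x ys ≡ γ x zs → ys ≡ zs
γ-injective x []       []       eq = refl
γ-injective x []       (q ∷ zs) eq =
  contradiction (↭ₚ.↭-empty-inv (subst (q ∷ zs ↭_) (sym eq) (↭-sym (γ-↭ x (q ∷ zs))))) λ ()
γ-injective x (p ∷ ys) []       eq =
  contradiction (↭ₚ.↭-empty-inv (subst (p ∷ ys ↭_) eq (↭-sym (γ-↭ x (p ∷ ys))))) λ ()
γ-injective x (p ∷ ys) (q ∷ zs) eq with x <? p | x <? q
... | yes x<p | yes x<q = rotate-injective (x <?_) x<p x<q ys zs eq
... | yes x<p | no  x≮q = contradiction eq (rotations-differ x<p x≮q ys zs)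
... | no  x≮p | yes x<q = contradiction (sym eq) (rotations-differ x<q x≮p zs ys)
... | no  x≮p | no  x≮q = rotate-injective (¬? ∘ (x <?_)) x≮p x≮q ys zs eq

foata₂ : List ℤ → List ℤ
foata₂ []      = []
foata₂ (x ∷ u) = x ∷ γ x (foata₂ u)

foata₂-↭ : ∀ u → foata₂ u ↭ u
foata₂-↭ []      = ↭-refl
foata₂-↭ (x ∷ u) = prep x (↭-trans (γ-↭ x (foata₂ u)) (foata₂-↭ u))

foata₂-injective : ∀ u v → foata₂ u ≡ foata₂ v → u ≡ v
foata₂-injective []      []      eq = refl
foata₂-injective (x ∷ u) (y ∷ v) eq
  with refl ← Listₚ.∷-injectiveˡ eq =
  cong (x ∷_) (foata₂-injective u v (γ-injective x _ _ (Listₚ.∷-injectiveʳ eq)))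

-- The `count` term is what `x` contributes to `inv` when it comes last. If `x < y`, the rotation
-- creates one inversion for each letter of `z` not above `x`, so with the contribution of `x` every
-- letter of `y ∷ z` counts once. Otherwise it destroys one inversion for each letter above `x`,
-- exactly as many as `x` brings.
inv-γ : ∀ x y z →
  inv (reverse (γ x (y ∷ z))) + count (x <?_) (y ∷ z) ≡
  𝟙 (x <? y) * suc (length z) + inv (reverse (y ∷ z))
inv-γ x y z rewrite count-∷ (x <?_) y z with x <? y
... | yes x<y = begin
  I + suc c            ≡⟨ cong (_+ suc c) (sym (ℕₚ.+-identityʳ I)) ⟩
  (I + 0) + suc c      ≡⟨ cong (_+ suc c) (inv-rotate (x <?_) cross x<y z) ⟩
  (J + 1 * n) + suc c  ≡⟨ arith J n c ⟩
  suc (c + n) + J      ≡⟨ cong (λ l → suc l + J) (count-complement (x <?_) z) ⟩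
  suc (length z) + J   ≡⟨ cong (_+ J) (sym (ℕₚ.*-identityˡ (suc (length z)))) ⟩
  1 * suc (length z) + J ∎
  where
  open ≡-Reasoning
  I = inv (reverse (rotate (x <?_) y z))
  J = inv (reverse (y ∷ z))
  c = count (x <?_) z
  n = count (¬? ∘ (x <?_)) z
  cross : ∀ {p q} → x < p → ¬ x < q → 𝟙 (p <? q) ≡ 0 × 𝟙 (q <? p) ≡ 1
  cross x<p x≮q =
    𝟙-no (_ <? _) (λ p<q → x≮q (ℤₚ.<-trans x<p p<q)) ,
    𝟙-yes (_ <? _) (ℤₚ.≤-<-trans (ℤₚ.≮⇒≥ x≮q) x<p)
  arith : ∀ j n c → (j + 1 * n) + suc c ≡ suc (c + n) + j
  arith = solve-∀
... | no x≮y = begin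
  I + c        ≡⟨ cong (λ m → I + m) (sym (trans (ℕₚ.*-identityˡ _) (cong length ¬¬))) ⟩
  I + 1 * n    ≡⟨ inv-rotate (¬? ∘ (x <?_)) cross x≮y z ⟩
  J + 0        ≡⟨ ℕₚ.+-identityʳ J ⟩
  J            ∎
  where
  open ≡-Reasoning
  I = inv (reverse (rotate (¬? ∘ (x <?_)) y z))
  J = inv (reverse (y ∷ z))
  c = count (x <?_) z
  n = count (¬? ∘ ¬? ∘ (x <?_)) z
  ¬¬ : filter (¬? ∘ ¬? ∘ (x <?_)) z ≡ filter (x <?_) z
  ¬¬ = Listₚ.filter-≐ (¬? ∘ ¬? ∘ (x <?_)) (x <?_)
    (decidable-stable (x <? _) , (λ p ¬p → ¬p p)) z
  cross : ∀ {p q} → ¬ x < p → ¬ ¬ x < q → 𝟙 (p <? q) ≡ 1 × 𝟙 (q <? p) ≡ 0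
  cross x≮p ¬x≮q =
    let x<q = decidable-stable (x <? _) ¬x≮q
        p<q = ℤₚ.≤-<-trans (ℤₚ.≮⇒≥ x≮p) x<q
    in 𝟙-yes (_ <? _) p<q , 𝟙-no (_ <? _) (ℤₚ.<-asym p<q)

-- `foata₂` leaves the head of its argument in place, so the comparison deciding the branch of `γ x`
-- is the one deciding whether `x` adds a descent; the increments of `inv` and `maj` then agree.
inv-foata₂ : ∀ u → inv (reverse (foata₂ u)) ≡ maj (reverse u)
inv-foata₂ []          = refl
inv-foata₂ (x ∷ [])    = refl
inv-foata₂ (x ∷ y ∷ u) = begin
  inv (reverse (foata₂ (x ∷ y ∷ u)))
    ≡⟨ inv-reverse-∷ x (γ x w) ⟩
  inv (reverse (γ x w)) + count (x <?_) (γ x w)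
    ≡⟨ cong (λ m → inv (reverse (γ x w)) + m) (count-↭ (x <?_) (γ-↭ x w)) ⟩
  inv (reverse (γ x w)) + count (x <?_) w
    ≡⟨ inv-γ x y _ ⟩
  𝟙 (x <? y) * suc (length (γ y (foata₂ u))) + inv (reverse w)
    ≡⟨ cong₂ (λ l i → 𝟙 (x <? y) * l + i) (↭ₚ.↭-length (foata₂-↭ (y ∷ u))) (inv-foata₂ (y ∷ u)) ⟩
  𝟙 (x <? y) * suc (length u) + maj (reverse (y ∷ u))
    ≡⟨ sym (maj-reverse-∷∷ x y u) ⟩
  maj (reverse (x ∷ y ∷ u)) ∎
  where
  open ≡-Reasoning
  w = foata₂ (y ∷ u)

-- Foata's first fundamental transformation

-- In the unreversed word, the left-to-right maximum leading the cycle that contains `x`. A next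
-- letter below it continues the cycle and is the top over `x`; any other starts a new cycle, and
-- the top over `x` is the leader. Either way the top is the smaller of the two.
peak : ℤ → List ℤ → ℤ
peak x []       = x
peak x (y ∷ ys) = x ⊔ peak y ys

≤-peak : ∀ x ys → All (_≤ peak x ys) (x ∷ ys)
≤-peak x []       = ℤₚ.≤-refl ∷ []
≤-peak x (y ∷ ys) =
  ℤₚ.i≤i⊔j x _ ∷ All.map (λ z≤ → ℤₚ.≤-trans z≤ (ℤₚ.i≤j⊔i x _)) (≤-peak y ys)

peak-∈ : ∀ x ys → peak x ys ∈ x ∷ ys
peak-∈ x []       = here refl
peak-∈ x (y ∷ ys) with ℤₚ.⊔-sel x (peak y ys)
... | inj₁ eq = here eq
... | inj₂ eq = there (subst (_∈ y ∷ ys) (sym eq) (peak-∈ y ys))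

peak-↭ : ∀ {x y xs ys} → x ∷ xs ↭ y ∷ ys → peak x xs ≡ peak y ys
peak-↭ {x} {y} {xs} {ys} p = ℤₚ.≤-antisym
  (All.lookup (≤-peak y ys) (↭ₚ.∈-resp-↭ p (peak-∈ x xs)))
  (All.lookup (≤-peak x xs) (↭ₚ.∈-resp-↭ (↭-sym p) (peak-∈ y ys)))

-- The pairs are the columns (top , bottom) of Foata's two-row array.
columns : ℤ → List ℤ → List (ℤ × ℤ)
columns x []       = []
columns x (y ∷ ys) = (x ⊓ peak y ys , y) ∷ columns y ys

bottoms-columns : ∀ x ys → map proj₂ (columns x ys) ≡ ys
bottoms-columns x []       = refl
bottoms-columns x (y ∷ ys) = cong (y ∷_) (bottoms-columns y ys)

⊔⊓-↭ : ∀ x y zs → x ⊔ y ∷ x ⊓ y ∷ zs ↭ x ∷ y ∷ zs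
⊔⊓-↭ x y zs with ℤₚ.≤-total x y
... | inj₁ x≤y rewrite ℤₚ.i≤j⇒i⊔j≡j x≤y | ℤₚ.i≤j⇒i⊓j≡i x≤y = swap y x ↭-refl
... | inj₂ y≤x rewrite ℤₚ.i≥j⇒i⊔j≡i y≤x | ℤₚ.i≥j⇒i⊓j≡j y≤x = ↭-refl

-- Comparing `x` with the maximum of the rest leaves the smaller one as a top and carries the larger
-- one on as the new maximum, so no letter is lost.
tops-columns : ∀ x ys → peak x ys ∷ map proj₁ (columns x ys) ↭ x ∷ ys
tops-columns x []       = ↭-refl
tops-columns x (y ∷ ys) =
  ↭-trans (⊔⊓-↭ x (peak y ys) _) (prep x (tops-columns y ys))

maximum : List ℤ → ℤ
maximum []       = 0ℤ   -- junk value
maximum (y ∷ ys) = peak y ys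

-- The first letter has no predecessor; the maximum stands in for it.
closedColumns : List ℤ → List (ℤ × ℤ)
closedColumns u = columns (maximum u) u

tops-closedColumns : ∀ u → map proj₁ (closedColumns u) ↭ u
tops-closedColumns []       = ↭-refl
-- The stand-in is the maximum itself, so the peak of the lengthened word is that same letter, and
-- the two cancel.
tops-closedColumns (y ∷ ys) = ↭ₚ.drop-∷
  (subst (λ m → m ∷ map proj₁ (columns (peak y ys) (y ∷ ys)) ↭ peak y ys ∷ y ∷ ys)
         (ℤₚ.⊔-idem (peak y ys))
         (tops-columns (peak y ys) (y ∷ ys)))

maximum-↭ : ∀ {u v} → u ↭ v → maximum u ≡ maximum v
maximum-↭ {[]}    {[]}    p = refl
maximum-↭ {_ ∷ _} {_ ∷ _} p = peak-↭ p
maximum-↭ {[]}    {_ ∷ _} p = contradiction (↭ₚ.↭-empty-inv (↭-sym p)) λ ()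
maximum-↭ {_ ∷ _} {[]}    p = contradiction (↭ₚ.↭-empty-inv p) λ ()

exceeds? : (c : ℤ × ℤ) → Dec (proj₁ c < proj₂ c)
exceeds? (t , b) = t <? b

-- Capping `x` by a maximum that is at least `y` does not affect whether it lies below `y`.
count-columns : ∀ x y ys →
  count exceeds? (columns x (y ∷ ys)) ≡ 𝟙 (x <? y) + count exceeds? (columns y ys)
count-columns x y ys = trans (count-∷ exceeds? (x ⊓ peak y ys , y) (columns y ys))
  (cong (_+ count exceeds? (columns y ys)) same)
  where
  same : 𝟙 (x ⊓ peak y ys <? y) ≡ 𝟙 (x <? y)
  same with x <? y
  ... | yes x<y = 𝟙-yes (_ <? _) (ℤₚ.≤-<-trans (ℤₚ.i⊓j≤i x _) x<y)
  ... | no  x≮y = 𝟙-no (_ <? _)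
    (ℤₚ.≤⇒≯ (ℤₚ.⊓-glb (ℤₚ.≮⇒≥ x≮y) (All.head (≤-peak y ys))))

des-columns : ∀ x u → count exceeds? (columns x u) ≡ des (reverse (x ∷ u))
des-columns x []       = refl
des-columns x (y ∷ ys) = trans (count-columns x y ys)
  (trans (cong (λ m → 𝟙 (x <? y) + m) (des-columns y ys)) (sym (des-reverse-∷∷ x y ys)))

des-closedColumns : ∀ u → count exceeds? (closedColumns u) ≡ des (reverse u)
des-closedColumns []       = refl
-- The stand-in is at least `y`, so the extra first column adds nothing to the count.
des-closedColumns (y ∷ ys) = trans (count-columns (peak y ys) y ys) (cong₂ _+_
  (𝟙-no (_ <? _) (ℤₚ.≤⇒≯ (All.head (≤-peak y ys)))) (des-columns y ys))

-- Columns with a given top are met in the order of u, so the first one of them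
-- reads off the next letter.
columns-injective : ∀ x u v → u ↭ v →
  (∀ a → filter ((_≟ a) ∘ proj₁) (columns x u) ≡ filter ((_≟ a) ∘ proj₁) (columns x v)) →
  u ≡ v
columns-injective x []       []       p eqs = refl
columns-injective x []       (z ∷ zs) p eqs = sym (↭ₚ.↭-empty-inv (↭-sym p))
columns-injective x (y ∷ ys) []       p eqs = ↭ₚ.↭-empty-inv p
-- The first top depends only on `x` and the multiset of letters, so it is common to both arrays and
-- selects the same filter.
columns-injective x (y ∷ ys) (z ∷ zs) p eqs = go t (cong (x ⊓_) (sym (peak-↭ p))) eqs
  where
  t = x ⊓ peak y ys
  go : ∀ t {t′} → t′ ≡ t →
    (∀ a → filter ((_≟ a) ∘ proj₁) ((t , y) ∷ columns y ys) ≡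
           filter ((_≟ a) ∘ proj₁) ((t′ , z) ∷ columns z zs)) →
    y ∷ ys ≡ z ∷ zs
  go t refl eqs
    with refl ← cong proj₂ (Listₚ.∷-injectiveˡ
      (trans (sym (Listₚ.filter-accept ((_≟ t) ∘ proj₁) refl))
        (trans (eqs t) (Listₚ.filter-accept ((_≟ t) ∘ proj₁) refl))))
    = cong (y ∷_) (columns-injective y ys zs (↭ₚ.drop-∷ p) rest)
    where
    rest : ∀ a → filter ((_≟ a) ∘ proj₁) (columns y ys) ≡
                 filter ((_≟ a) ∘ proj₁) (columns y zs)
    rest a with t ≟ a | eqs a
    ... | yes _ | eq = Listₚ.∷-injectiveʳ eq
    ... | no  _ | eq = eq

-- Stable sorting by the top row.

byTop : DecTotalOrder 0ℓ 0ℓ 0ℓ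
byTop = On.decTotalOrder ℤₚ.≤-decTotalOrder (proj₁ {B = λ (_ : ℤ) → ℤ})

module S = InsertionSort byTop
module SA = SortingAlgorithm S.insertionSort

filter-∷-cong : ∀ {A : Set} {P : Pred A 0ℓ} (P? : Decidable P) x {xs ys} →
  filter P? xs ≡ filter P? ys → filter P? (x ∷ xs) ≡ filter P? (x ∷ ys)
filter-∷-cong P? x eq with does (P? x)
... | true  = cong (x ∷_) eq
... | false = eq

filter-swap : ∀ {A : Set} {P : Pred A 0ℓ} (P? : Decidable P) x y xs → ¬ (P x × P y) →
  filter P? (x ∷ y ∷ xs) ≡ filter P? (y ∷ x ∷ xs)
filter-swap P? x y xs ¬both with P? x
... | no  ¬Px = filter-∷-cong P? y (sym (Listₚ.filter-reject P? ¬Px))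
... | yes Px
  rewrite Listₚ.filter-reject P? {y} {xs} (λ Py → ¬both (Px , Py))
        | Listₚ.filter-reject P? {y} {x ∷ xs} (λ Py → ¬both (Px , Py))
  = sym (Listₚ.filter-accept P? Px)

-- This is stability: `c` passes `d` only when the top of `d` is strictly smaller, so at most one of
-- the two has top `a`.
filter-insert : ∀ a c cs →
  filter ((_≟ a) ∘ proj₁) (S.insert c cs) ≡ filter ((_≟ a) ∘ proj₁) (c ∷ cs)
filter-insert a c [] = refl
filter-insert a c (d ∷ cs) with proj₁ c ℤₚ.≤? proj₁ d
... | yes _  = refl
... | no c≰d = trans
  (filter-∷-cong ((_≟ a) ∘ proj₁) d (filter-insert a c cs))
  (filter-swap ((_≟ a) ∘ proj₁) d c cs
    λ (d≡a , c≡a) → c≰d (ℤₚ.≤-reflexive (trans c≡a (sym d≡a))))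

filter-sort : ∀ a cs →
  filter ((_≟ a) ∘ proj₁) (S.sort cs) ≡ filter ((_≟ a) ∘ proj₁) cs
filter-sort a []       = refl
filter-sort a (c ∷ cs) = trans (filter-insert a c (S.sort cs))
  (filter-∷-cong ((_≟ a) ∘ proj₁) c (filter-sort a cs))

↗-unique : ∀ {u v} → Sorted u → Sorted v → u ↭ v → u ≡ v
↗-unique u↗ v↗ p = Pointwise.Pointwise-≡⇒≡ (Sortedₚ.↗↭↗⇒≋ ℤₚ.≤-totalOrder u↗ v↗ (↭⇒↭ₛ p))

tops-sort : ∀ cs → map proj₁ (S.sort cs) ≡ sort (map proj₁ cs)
tops-sort cs = ↗-unique (Linkedₚ.map⁺ (SA.sort-↗ cs)) (sort-↗ _)
  (↭-trans (↭ₚ.map⁺ proj₁ (SA.sort-↭ cs)) (↭-sym (sort-↭ _)))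

sort-cong : ∀ {u v} → u ↭ v → sort u ≡ sort v
sort-cong p = ↗-unique (sort-↗ _) (sort-↗ _) (↭-trans (sort-↭ _) (↭-trans p (↭-sym (sort-↭ _))))

foata₁ : List ℤ → List ℤ
foata₁ u = map proj₂ (S.sort (closedColumns u))

foata₁-↭ : ∀ u → foata₁ u ↭ u
foata₁-↭ u = ↭-trans (↭ₚ.map⁺ proj₂ (SA.sort-↭ (closedColumns u)))
  (↭-reflexive (bottoms-columns (maximum u) u))

-- The sorted top row is the word with which `exc` compares the bottom row, so the excedances of the
-- image are the columns whose top is below their bottom.
tops-foata₁ : ∀ u → map proj₁ (S.sort (closedColumns u)) ≡ sort u
tops-foata₁ u = trans (tops-sort (closedColumns u)) (sort-cong (tops-closedColumns u))

zip-map : ∀ (cs : List (ℤ × ℤ)) → zip (map proj₂ cs) (map proj₁ cs) ≡ map Product.swap cs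
zip-map []       = refl
zip-map (c ∷ cs) = cong (_ ∷_) (zip-map cs)

exc-foata₁ : ∀ u → exc (foata₁ u) ≡ des (reverse u)
exc-foata₁ u = begin
  exc (foata₁ u)
    ≡⟨ cong (λ s → below (zip (foata₁ u) s))
         (trans (sort-cong (foata₁-↭ u)) (sym (tops-foata₁ u))) ⟩
  below (zip (foata₁ u) (map proj₁ (S.sort (closedColumns u))))
    ≡⟨ cong below (zip-map (S.sort (closedColumns u))) ⟩
  below (map Product.swap (S.sort (closedColumns u)))
    ≡⟨ below-swap (S.sort (closedColumns u)) ⟩
  count exceeds? (S.sort (closedColumns u))
    ≡⟨ count-↭ exceeds? (SA.sort-↭ (closedColumns u)) ⟩
  count exceeds? (closedColumns u)
    ≡⟨ des-closedColumns u ⟩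
  des (reverse u) ∎
  where
  open ≡-Reasoning
  below : List (ℤ × ℤ) → ℕ
  below = count (λ (a , s) → s <? a)
  below-swap : ∀ cs → below (map Product.swap cs) ≡ count exceeds? cs
  below-swap []       = refl
  below-swap ((t , b) ∷ cs) = trans (count-∷ _ (b , t) (map Product.swap cs))
    (trans (cong (λ m → 𝟙 (t <? b) + m) (below-swap cs)) (sym (count-∷ exceeds? (t , b) cs)))

-- The image fixes the multiset of letters, hence the sorted top row, hence the whole sorted array.
-- By stability this still shows the columns of each given top in their original order, which is
-- what `columns-injective` asks.
foata₁-injective : ∀ u v → foata₁ u ≡ foata₁ v → u ≡ v
foata₁-injective u v eq = columns-injective (maximum u) u v u↭v λ a → begin
  filter ((_≟ a) ∘ proj₁) (closedColumns u)
    ≡⟨ filter-sort a (closedColumns u) ⟨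
  filter ((_≟ a) ∘ proj₁) (S.sort (closedColumns u))
    ≡⟨ cong (filter ((_≟ a) ∘ proj₁)) sorted ⟩
  filter ((_≟ a) ∘ proj₁) (S.sort (closedColumns v))
    ≡⟨ filter-sort a (closedColumns v) ⟩
  filter ((_≟ a) ∘ proj₁) (closedColumns v)
    ≡⟨ cong (λ x → filter ((_≟ a) ∘ proj₁) (columns x v)) (maximum-↭ u↭v) ⟨
  filter ((_≟ a) ∘ proj₁) (columns (maximum u) v) ∎
  where
  open ≡-Reasoning
  u↭v : u ↭ v
  u↭v = ↭-trans (↭-sym (foata₁-↭ u)) (↭-trans (↭-reflexive eq) (foata₁-↭ v))
  swap-injective : ∀ {c d : ℤ × ℤ} → Product.swap c ≡ Product.swap d → c ≡ d
  swap-injective refl = refl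
  sorted : S.sort (closedColumns u) ≡ S.sort (closedColumns v)
  sorted = Listₚ.map-injective swap-injective
    (trans (sym (zip-map (S.sort (closedColumns u))))
      (trans (cong₂ zip eq
               (trans (tops-foata₁ u) (trans (sort-cong u↭v) (sym (tops-foata₁ v)))))
             (zip-map (S.sort (closedColumns v)))))

-- Standard words

-- The pigeonhole principle. It serves for the positive letters of a standard word, for injective
-- self-maps of `Fin n`, and for the transformations acting on the list of all standard words.
Unique⊆⇒↭ : ∀ {A : Set} {xs ys : List A} → Unique xs →
  (∀ {x} → x ∈ xs → x ∈ ys) → length ys ℕ.≤ length xs → xs ↭ ys
Unique⊆⇒↭ {xs = []}     {[]} _ _ _ = ↭-refl
Unique⊆⇒↭ {xs = x ∷ xs} {ys} (x∉xs ∷ xs!) xs⊆ys ys≤xs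
  with as , bs , refl ← ∈ₚ.∈-∃++ (xs⊆ys (here refl)) =
  ↭-trans (prep x (Unique⊆⇒↭ xs! xs⊆ short)) (↭-sym split)
  where
  split : ys ↭ x ∷ as ++ bs
  split = ↭ₚ.shift x as bs
  xs⊆ : ∀ {z} → z ∈ xs → z ∈ as ++ bs
  xs⊆ z∈xs with ↭ₚ.∈-resp-↭ split (xs⊆ys (there z∈xs))
  ... | here refl = contradiction refl (All.lookup x∉xs z∈xs)
  ... | there z∈  = z∈
  short : length (as ++ bs) ℕ.≤ length xs
  short = ℕ.s≤s⁻¹ (subst (ℕ._≤ suc (length xs)) (↭ₚ.↭-length split) ys≤xs)

filter-partition-↭ : ∀ {A : Set} {P : Pred A 0ℓ} (P? : Decidable P) xs →
  xs ↭ filter P? xs ++ filter (¬? ∘ P?) xs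
filter-partition-↭ P? [] = ↭-refl
filter-partition-↭ P? (x ∷ xs) with does (P? x)
... | true  = prep x (filter-partition-↭ P? xs)
... | false = ↭-trans (prep x (filter-partition-↭ P? xs))
                      (↭-sym (↭ₚ.shift x (filter P? xs) _))

module _ {A : Set} {P Q : Pred A 0ℓ} (P? : Decidable P) (Q? : Decidable Q)
         (P⊆Q : ∀ {x} → P x → Q x) where

  count-mono-≤ : ∀ xs → count P? xs ℕ.≤ count Q? xs
  count-mono-≤ []       = z≤n
  count-mono-≤ (x ∷ xs) with P? x | Q? x
  ... | yes _  | yes _  = s≤s (count-mono-≤ xs)
  ... | yes Px | no ¬Qx = contradiction (P⊆Q Px) ¬Qx
  ... | no _   | yes _  = ℕₚ.m≤n⇒m≤1+n (count-mono-≤ xs)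
  ... | no _   | no _   = count-mono-≤ xs

  count-mono-< : ∀ {xs z} → z ∈ xs → ¬ P z → Q z → count P? xs ℕ.< count Q? xs
  count-mono-< {x ∷ xs} (here refl) ¬Pz Qz with P? x | Q? x
  ... | yes Px | _      = contradiction Px ¬Pz
  ... | no _   | yes _  = s≤s (count-mono-≤ xs)
  ... | no _   | no ¬Qx = contradiction Qz ¬Qx
  count-mono-< {x ∷ xs} (there z∈xs) ¬Pz Qz with P? x | Q? x
  ... | yes _  | yes _  = s≤s (count-mono-< z∈xs ¬Pz Qz)
  ... | yes Px | no ¬Qx = contradiction (P⊆Q Px) ¬Qx
  ... | no _   | yes _  = ℕₚ.m≤n⇒m≤1+n (count-mono-< z∈xs ¬Pz Qz)
  ... | no _   | no _   = count-mono-< z∈xs ¬Pz Qz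

count-map : ∀ {A B : Set} {P : Pred A 0ℓ} {Q : Pred B 0ℓ}
  (P? : Decidable P) (Q? : Decidable Q) (f : A → B) xs →
  All (λ x → (Q (f x) → P x) × (P x → Q (f x))) xs →
  count Q? (map f xs) ≡ count P? xs
count-map P? Q? f []       _ = refl
count-map P? Q? f (x ∷ xs) ((to , from) ∷ h) with P? x | Q? (f x)
... | yes _  | yes _  = cong suc (count-map P? Q? f xs h)
... | yes Px | no ¬Q  = contradiction (from Px) ¬Q
... | no ¬Px | yes Qf = contradiction (to Qf) ¬Px
... | no _   | no _   = count-map P? Q? f xs h

tabulate-injective : ∀ {A : Set} {n} {f g : Fin n → A} → tabulate f ≡ tabulate g → ∀ i → f i ≡ g i
tabulate-injective eq Fin.zero    = Listₚ.∷-injectiveˡ eq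
tabulate-injective eq (Fin.suc i) = tabulate-injective (Listₚ.∷-injectiveʳ eq) i

AllPairs-tabulate⁻ : ∀ {A : Set} {R : A → A → Set} → Symmetric R → ∀ {n} {f : Fin n → A} →
  AllPairs R (tabulate f) → ∀ {i j} → i ≢ j → R (f i) (f j)
AllPairs-tabulate⁻ R-sym (px ∷ _)   {Fin.zero}  {Fin.zero}  i≢j = contradiction refl i≢j
AllPairs-tabulate⁻ R-sym (px ∷ _)   {Fin.zero}  {Fin.suc j} i≢j = Allₚ.tabulate⁻ px j
AllPairs-tabulate⁻ R-sym (px ∷ _)   {Fin.suc i} {Fin.zero}  i≢j = R-sym (Allₚ.tabulate⁻ px i)
AllPairs-tabulate⁻ R-sym (_ ∷ pxs) {Fin.suc i} {Fin.suc j} i≢j =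
  AllPairs-tabulate⁻ R-sym pxs (i≢j ∘ cong Fin.suc)

-- Ranks and relabelling.

Upto : ℤ → Pred ℤ 0ℓ
Upto x y = 0ℤ < y × y ≤ x

upto? : ∀ x → Decidable (Upto x)
upto? x y = (0ℤ <? y) ×-dec (y ≤? x)

rank : List ℤ → ℤ → ℕ
rank w x = count (upto? x) w

rank-mono-≤ : ∀ w {x y} → x ≤ y → rank w x ℕ.≤ rank w y
rank-mono-≤ w x≤y =
  count-mono-≤ (upto? _) (upto? _) (Product.map₂ (λ z≤x → ℤₚ.≤-trans z≤x x≤y)) w

rank-mono-< : ∀ {w x y} → y ∈ w → 0ℤ < y → x < y → rank w x ℕ.< rank w y
rank-mono-< y∈w 0<y x<y =
  count-mono-< (upto? _) (upto? _) (Product.map₂ (λ z≤x → ℤₚ.≤-trans z≤x (ℤₚ.<⇒≤ x<y)))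
    y∈w (λ (_ , y≤x) → ℤₚ.<⇒≱ x<y y≤x) (0<y , ℤₚ.≤-refl)

rank-cancel-≤ : ∀ {w x y} → x ∈ w → 0ℤ < x → rank w x ℕ.≤ rank w y → x ≤ y
rank-cancel-≤ x∈w 0<x r≤ = ℤₚ.≮⇒≥ (λ y<x → ℕₚ.<⇒≱ (rank-mono-< x∈w 0<x y<x) r≤)

rank>0 : ∀ {w x} → x ∈ w → 0ℤ < x → 0 ℕ.< rank w x
rank>0 x∈w 0<x = ∈ₚ.∈-length (∈ₚ.∈-filter⁺ (upto? _) x∈w (0<x , ℤₚ.≤-refl))

relabel-pos : ∀ w {x} → 0ℤ < x → relabel w x ≡ + rank w x
relabel-pos w {x} 0<x with 0ℤ <? x
... | yes _  = refl
... | no 0≮x = contradiction 0<x 0≮x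

relabel-nonpos : ∀ w {x} → ¬ 0ℤ < x → relabel w x ≡ x
relabel-nonpos w {x} 0≮x with 0ℤ <? x
... | yes 0<x = contradiction 0<x 0≮x
... | no _    = refl

relabel-↭ : ∀ {w v} → w ↭ v → ∀ x → relabel w x ≡ relabel v x
relabel-↭ p x with 0ℤ <? x
... | yes _ = cong +_ (count-↭ (upto? x) p)
... | no _  = refl

relabel>0 : ∀ {w x} → x ∈ w → 0ℤ < x → 0ℤ < relabel w x
relabel>0 {w} x∈w 0<x rewrite relabel-pos w 0<x = +<+ (rank>0 x∈w 0<x)

relabel>0⁻ : ∀ w {x} → 0ℤ < relabel w x → 0ℤ < x
relabel>0⁻ w {x} 0<r with 0ℤ <? x
... | yes 0<x = 0<x
... | no _    = 0<r

-- Relabelling preserves the sign of the letters of `w`, is strictly increasing on the positive ones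
-- and fixes the others.
relabel-injective : ∀ {w x y} → x ∈ w → y ∈ w → relabel w x ≡ relabel w y → x ≡ y
relabel-injective {w} {x} {y} x∈w y∈w eq = go (0ℤ <? x) (0ℤ <? y)
  where
  go : Dec (0ℤ < x) → Dec (0ℤ < y) → x ≡ y
  go (yes 0<x) (yes 0<y) = ℤₚ.≤-antisym
    (rank-cancel-≤ x∈w 0<x (ℕₚ.≤-reflexive eq′))
    (rank-cancel-≤ y∈w 0<y (ℕₚ.≤-reflexive (sym eq′)))
    where
    eq′ : rank w x ≡ rank w y
    eq′ = ℤₚ.+-injective (trans (sym (relabel-pos w 0<x)) (trans eq (relabel-pos w 0<y)))
  go (yes 0<x) (no 0≮y) =
    contradiction (relabel>0⁻ w (subst (0ℤ <_) eq (relabel>0 x∈w 0<x))) 0≮y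
  go (no 0≮x) (yes 0<y) =
    contradiction (relabel>0⁻ w (subst (0ℤ <_) (sym eq) (relabel>0 y∈w 0<y))) 0≮x
  go (no 0≮x) (no 0≮y) = trans (sym (relabel-nonpos w 0≮x)) (trans eq (relabel-nonpos w 0≮y))

-- Relabelling preserves and reflects the order of the positive letters, so a second relabelling
-- finds the same ranks. Being fixed by `relabel` is thus the mark of a standardised word.
relabel-standardise : ∀ {w x} → x ∈ w → relabel (standardise w) (relabel w x) ≡ relabel w x
relabel-standardise {w} {x} x∈w with 0ℤ <? x
... | no 0≮x = relabel-nonpos (standardise w) 0≮x
... | yes 0<x = trans (relabel-pos (standardise w) (+<+ (rank>0 x∈w 0<x)))
  (cong +_ (count-map (upto? x) (upto? (+ rank w x)) (relabel w) w
    (All.tabulate λ {y} y∈w → to y∈w , from y∈w)))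
  where
  to : ∀ {y} → y ∈ w → Upto (+ rank w x) (relabel w y) → Upto x y
  to {y} y∈w (0<r , r≤) = 0<y ,
    rank-cancel-≤ y∈w 0<y (ℤₚ.drop‿+≤+ (subst (_≤ + rank w x) (relabel-pos w 0<y) r≤))
    where
    0<y : 0ℤ < y
    0<y = relabel>0⁻ w 0<r
  from : ∀ {y} → y ∈ w → Upto x y → Upto (+ rank w x) (relabel w y)
  from y∈w (0<y , y≤x) = relabel>0 y∈w 0<y ,
    subst (_≤ + rank w x) (sym (relabel-pos w 0<y)) (+≤+ (rank-mono-≤ w y≤x))

-- The upper end of the alphabet is enforced in `Standard`: there a positive letter equals its own
-- rank, which is at most the number of positive letters.
Letter : ℕ → Pred ℤ 0ℓ
Letter k x = - (+ k) < x × x ≢ 0ℤ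

letter? : ∀ k → Decidable (Letter k)
letter? k x = (- (+ k) <? x) ×-dec ¬? (x ≟ 0ℤ)

positive⇒Letter : ∀ {k x} → 0ℤ < x → Letter k x
positive⇒Letter {k} 0<x =
  ℤₚ.≤-<-trans (ℤₚ.neg-≤-pos {k} {0}) 0<x , λ x≡0 → ℤₚ.<-irrefl (sym x≡0) 0<x

Apart : ℤ → ℤ → Set
Apart x y = 0ℤ < x → x ≢ y

Apart-sym : Symmetric Apart
Apart-sym x#y 0<y refl = x#y 0<y refl

PositivesDistinct : Pred (List ℤ) 0ℓ
PositivesDistinct = AllPairs Apart

positivesDistinct? : Decidable PositivesDistinct
positivesDistinct? = allPairs? (λ x y → (0ℤ <? x) →-dec ¬? (x ≟ y))

PositivesDistinct-resp-↭ : ∀ {v w} → v ↭ w → PositivesDistinct v → PositivesDistinct w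
PositivesDistinct-resp-↭ p = ↭ₛₚ.AllPairs-resp-↭ (setoid ℤ) Apart-sym (resp₂ Apart) (↭⇒↭ₛ p)

-- The permutation forms of the k-arrangements, for k ≥ 1.
Standard : ℕ → Pred (List ℤ) 0ℓ
Standard k v = All (λ x → relabel v x ≡ x × Letter k x) v × PositivesDistinct v

standard? : ∀ k → Decidable (Standard k)
standard? k v =
  All.all? (λ x → (relabel v x ≟ x) ×-dec letter? k x) v ×-dec positivesDistinct? v

Standard-resp-↭ : ∀ {k v w} → v ↭ w → Standard k v → Standard k w
Standard-resp-↭ p (fixed , distinct) =
  All.map (λ {x} → Product.map₁ (trans (sym (relabel-↭ p x)))) (↭ₚ.All-resp-↭ p fixed) ,
  PositivesDistinct-resp-↭ p distinct

standardise-Standard : ∀ {k w} → All (Letter k) w → PositivesDistinct w →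
  Standard k (standardise w)
standardise-Standard {k} {w} letters distinct =
  Allₚ.map⁺ (All.tabulate λ x∈w → relabel-standardise x∈w , letter⁺ x∈w) ,
  AllPairsₚ.map⁺ (apart w (λ x∈w → x∈w) distinct)
  where
  letter⁺ : ∀ {x} → x ∈ w → Letter k (relabel w x)
  letter⁺ {x} x∈w with 0ℤ <? x
  ... | yes 0<x = positive⇒Letter (+<+ (rank>0 x∈w 0<x))
  ... | no _    = All.lookup letters x∈w
  apart : ∀ v → (∀ {x} → x ∈ v → x ∈ w) → PositivesDistinct v →
    AllPairs (λ x y → Apart (relabel w x) (relabel w y)) v
  apart []      v⊆w []         = []
  apart (x ∷ v) v⊆w (x# ∷ v#) =
    All.tabulate (λ y∈v 0<r eq → All.lookup x# y∈v (relabel>0⁻ w 0<r)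
      (relabel-injective (v⊆w (here refl)) (v⊆w (there y∈v)) eq)) ∷
    apart v (v⊆w ∘ there) v#

-- Applied letterwise, this retains exactly what standardisation cannot change: the nonpositive
-- letters and the positions of the positive ones.
clamp : ℤ → ℤ
clamp x = if does (0ℤ <? x) then 1ℤ else x

clamp-cases : ∀ x y → clamp x ≡ clamp y → (0ℤ < x × 0ℤ < y) ⊎ (¬ 0ℤ < x × x ≡ y)
clamp-cases x y eq with 0ℤ <? x | 0ℤ <? y
... | yes 0<x | yes 0<y = inj₁ (0<x , 0<y)
... | yes 0<x | no 0≮y  = contradiction (subst (0ℤ <_) eq (+<+ (s≤s z≤n))) 0≮y
... | no 0≮x  | yes 0<y = contradiction (subst (0ℤ <_) (sym eq) (+<+ (s≤s z≤n))) 0≮x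
... | no 0≮x  | no 0≮y  = inj₂ (0≮x , eq)

clamp-pos : ∀ {x} → 0ℤ < x → clamp x ≡ 1ℤ
clamp-pos {x} 0<x rewrite dec-true (0ℤ <? x) 0<x = refl

clamp-relabel : ∀ {w x} → x ∈ w → clamp (relabel w x) ≡ clamp x
clamp-relabel {w} {x} x∈w = go (0ℤ <? x)
  where
  go : Dec (0ℤ < x) → clamp (relabel w x) ≡ clamp x
  go (yes 0<x) = trans (clamp-pos (relabel>0 x∈w 0<x)) (sym (clamp-pos 0<x))
  go (no 0≮x)  = cong clamp (relabel-nonpos w 0≮x)

filter-clamp : ∀ u v → map clamp u ≡ map clamp v →
  count (0ℤ <?_) u ≡ count (0ℤ <?_) v × filter (¬? ∘ (0ℤ <?_)) u ≡ filter (¬? ∘ (0ℤ <?_)) v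
filter-clamp []      []      eq = refl , refl
filter-clamp (x ∷ u) (y ∷ v) eq
  with ih₁ , ih₂ ← filter-clamp u v (Listₚ.∷-injectiveʳ eq)
     | 0ℤ <? x | 0ℤ <? y | clamp-cases x y (Listₚ.∷-injectiveˡ eq)
... | yes _   | yes _   | _                 = cong suc ih₁ , ih₂
... | yes 0<x | no 0≮y  | inj₁ (_ , 0<y)    = contradiction 0<y 0≮y
... | yes 0<x | no 0≮y  | inj₂ (0≮x , _)    = contradiction 0<x 0≮x
... | no 0≮x  | yes _   | inj₁ (0<x , _)    = contradiction 0<x 0≮x
... | no 0≮x  | yes 0<y | inj₂ (_ , refl)   = contradiction 0<y 0≮x
... | no 0≮x  | no _    | inj₁ (0<x , _)    = contradiction 0<x 0≮x
... | no _    | no _    | inj₂ (_ , refl)   = ih₁ , cong (x ∷_) ih₂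

-- Each of the m positive letters equals its rank and so lies between 1 and m; being distinct, they
-- exhaust this range.
positives-↭ : ∀ {k v} → Standard k v →
  filter (0ℤ <?_) v ↭ map (+_ ∘ suc) (upTo (count (0ℤ <?_) v))
positives-↭ {k} {v} (fixed , distinct) = Unique⊆⇒↭
  (unique (Allₚ.all-filter (0ℤ <?_) v) (AllPairsₚ.filter⁺ (0ℤ <?_) distinct))
  bounded
  (ℕₚ.≤-reflexive (trans (Listₚ.length-map _ (upTo m)) (Listₚ.length-upTo m)))
  where
  m = count (0ℤ <?_) v
  unique : ∀ {u} → All (0ℤ <_) u → PositivesDistinct u → Unique u
  unique []            []        = []
  unique (0<x ∷ 0<u) (x# ∷ u#) = All.map (λ x#y → x#y 0<x) x# ∷ unique 0<u u#
  bounded : ∀ {x} → x ∈ filter (0ℤ <?_) v → x ∈ map (+_ ∘ suc) (upTo m)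
  bounded {x} x∈ with x∈v , 0<x ← ∈ₚ.∈-filter⁻ (0ℤ <?_) {xs = v} x∈ =
    go (trans (sym (relabel-pos v 0<x)) (proj₁ (All.lookup fixed x∈v)))
    where
    go : + rank v x ≡ x → x ∈ map (+_ ∘ suc) (upTo m)
    go eq with rank v x | rank>0 x∈v 0<x
             | count-mono-≤ (upto? x) (0ℤ <?_) proj₁ v
    ... | suc r | _ | r<m = subst (_∈ _) eq (∈ₚ.∈-map⁺ (+_ ∘ suc) (∈ₚ.∈-upTo⁺ r<m))

Standard-↭ : ∀ {k u v} → Standard k u → Standard k v → map clamp u ≡ map clamp v → u ↭ v
Standard-↭ {k} {u} {v} su sv eq with eq₁ , eq₂ ← filter-clamp u v eq = begin
  u                                                    ↭⟨ filter-partition-↭ (0ℤ <?_) u ⟩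
  filter (0ℤ <?_) u ++ filter (¬? ∘ (0ℤ <?_)) u        ↭⟨ ↭ₚ.++⁺ʳ _ (positives-↭ su) ⟩
  numbers (count (0ℤ <?_) u) ++ filter (¬? ∘ (0ℤ <?_)) u
    ≡⟨ cong₂ (λ m → numbers m ++_) eq₁ eq₂ ⟩
  numbers (count (0ℤ <?_) v) ++ filter (¬? ∘ (0ℤ <?_)) v
    ↭⟨ ↭ₚ.++⁺ʳ _ (positives-↭ sv) ⟨
  filter (0ℤ <?_) v ++ filter (¬? ∘ (0ℤ <?_)) v        ↭⟨ filter-partition-↭ (0ℤ <?_) v ⟨
  v                                                    ∎
  where
  open PermutationReasoning
  numbers : ℕ → List ℤ
  numbers m = map (+_ ∘ suc) (upTo m)

-- Permutation forms of arrangements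

Injective⇒↭ : ∀ {n} {f : Fin n → Fin n} → (∀ {i j} → f i ≡ f j → i ≡ j) → tabulate f ↭ allFin n
Injective⇒↭ {n} {f} f-inj = Unique⊆⇒↭ (Uniqueₚ.tabulate⁺ f-inj) (λ _ → ∈ₚ.∈-allFin _)
  (ℕₚ.≤-reflexive (trans (Listₚ.length-tabulate (λ i → i)) (sym (Listₚ.length-tabulate f))))

injective⇒permutation : ∀ {n} (f : Fin n → Fin n) → (∀ {i j} → f i ≡ f j → i ≡ j) →
  ∃ λ (π : Permutation′ n) → ∀ i → π ⟨$⟩ʳ i ≡ f i
injective⇒permutation f f-inj =
  permutation f (proj₁ ∘ preimage) f∘preimage (f-inj ∘ f∘preimage ∘ f) , λ _ → refl
  where
  preimage : ∀ j → ∃ λ i → j ≡ f i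
  preimage j = ∈ₚ.∈-tabulate⁻ (↭ₚ.∈-resp-↭ (↭-sym (Injective⇒↭ f-inj)) (∈ₚ.∈-allFin j))
  f∘preimage : ∀ j → f (proj₁ (preimage j)) ≡ j
  f∘preimage j = sym (proj₂ (preimage j))

permutation-injective : ∀ {n} (π : Permutation′ n) {i j} → π ⟨$⟩ʳ i ≡ π ⟨$⟩ʳ j → i ≡ j
permutation-injective π {i} {j} eq =
  trans (sym (inverseˡ π)) (trans (cong (π ⟨$⟩ˡ_) eq) (inverseˡ π))

fixedLetter-pos : ∀ {n k} (i : Fin n) (c : Fin k) →
  0ℤ < fixedLetter i c → fixedLetter i c ≡ + suc (toℕ i)
fixedLetter-pos {k = k} i c 0<l with suc (toℕ c) ℕ.≟ k
... | yes _ = refl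

fixedLetter-Letter : ∀ {n k} (i : Fin n) (c : Fin k) → Letter k (fixedLetter i c)
fixedLetter-Letter {k = k} i c with suc (toℕ c) ℕ.≟ k
... | yes _   = positive⇒Letter {k} (+<+ (s≤s z≤n))
... | no c+1≢k = ℤₚ.neg-mono-< (+<+ (ℕₚ.≤∧≢⇒< (Finₚ.toℕ<n c) c+1≢k)) , λ ()

fixedLetter-injective : ∀ {n k} (i : Fin n) {c d : Fin k} →
  fixedLetter i c ≡ fixedLetter i d → c ≡ d
fixedLetter-injective {k = k} i {c} {d} eq with suc (toℕ c) ℕ.≟ k | suc (toℕ d) ℕ.≟ k
... | yes c+1≡k | yes d+1≡k = Finₚ.toℕ-injective (ℕₚ.suc-injective (trans c+1≡k (sym d+1≡k)))
... | no _      | no _      = Finₚ.toℕ-injective (ℤₚ.-[1+-injective eq)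

-- This is where `k ≥ 1` enters: a fixed point keeping its positive letter must carry the colour k,
-- the last element of `Fin k`.
fixedLetter-surjective : ∀ {n k} (i : Fin n) → k ≥ 1 → ∀ {x} → Letter k x →
  (0ℤ < x → x ≡ + suc (toℕ i)) → ∃ λ (c : Fin k) → fixedLetter i c ≡ x
fixedLetter-surjective i k≥1 {+ zero} (_ , x≢0) _ = contradiction refl x≢0
fixedLetter-surjective {k = suc k} i k≥1 {+ suc x} _ x≡ = Fin.fromℕ k , eq
  where
  eq : fixedLetter i (Fin.fromℕ k) ≡ + suc x
  eq with suc (toℕ (Fin.fromℕ k)) ℕ.≟ suc k
  ... | yes _ = sym (x≡ (+<+ (s≤s z≤n)))
  ... | no ≢  = contradiction (cong suc (Finₚ.toℕ-fromℕ k)) ≢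
fixedLetter-surjective {k = k} i k≥1 { -[1+ c ]} (-k<x , _) _ = fromℕ< c<k , eq
  where
  c+1<k : suc c ℕ.< k
  c+1<k = ℤₚ.drop‿+<+ (ℤₚ.neg-cancel-< {+ k} {+ suc c} -k<x)
  c<k : c ℕ.< k
  c<k = ℕₚ.<⇒≤ c+1<k
  eq : fixedLetter i (fromℕ< c<k) ≡ -[1+ c ]
  eq with suc (toℕ (fromℕ< c<k)) ℕ.≟ k
  ... | yes ≡k = contradiction (trans (cong suc (sym (Finₚ.toℕ-fromℕ< c<k))) ≡k) (ℕₚ.<⇒≢ c+1<k)
  ... | no _   = cong -[1+_] (Finₚ.toℕ-fromℕ< c<k)

normal : ∀ {n} → Fin n → ℤ → ℤ
normal i x = if does (0ℤ <? x) then + suc (toℕ i) else x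

normal-pos : ∀ {n} (i : Fin n) {x} → 0ℤ < x → normal i x ≡ + suc (toℕ i)
normal-pos i {x} 0<x rewrite dec-true (0ℤ <? x) 0<x = refl

normal-nonpos : ∀ {n} (i : Fin n) {x} → ¬ 0ℤ < x → normal i x ≡ x
normal-nonpos i {x} 0≮x rewrite dec-false (0ℤ <? x) 0≮x = refl

normal>0⁻ : ∀ {n} (i : Fin n) x → 0ℤ < normal i x → 0ℤ < x
normal>0⁻ i x 0<n with 0ℤ <? x
... | yes 0<x = 0<x
... | no _    = 0<n

clamp-normal : ∀ {n} (i : Fin n) x → clamp (normal i x) ≡ clamp x
clamp-normal i x = go (0ℤ <? x)
  where
  go : Dec (0ℤ < x) → clamp (normal i x) ≡ clamp x
  go (yes 0<x) = trans (cong clamp (normal-pos i 0<x)) (sym (clamp-pos 0<x))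
  go (no 0≮x)  = cong clamp (normal-nonpos i 0≮x)

normal-cong : ∀ {n} (i : Fin n) x y → clamp x ≡ clamp y → normal i x ≡ normal i y
normal-cong i x y eq with clamp-cases x y eq
... | inj₁ (0<x , 0<y) = trans (normal-pos i 0<x) (sym (normal-pos i 0<y))
... | inj₂ (_ , x≡y)   = cong (normal i) x≡y

-- The letters of an arrangement before standardisation, up to order: a letter i at
-- each position i that carries no negative letter.
normalForm : ∀ {n} → (Fin n → ℤ) → List ℤ
normalForm w = tabulate (λ i → normal i (w i))

normalForm-distinct : ∀ {n} (w : Fin n → ℤ) → PositivesDistinct (normalForm w)
normalForm-distinct w = AllPairsₚ.tabulate⁺ λ {i} {j} i≢j 0<ni ni≡nj →
  let 0<wi = normal>0⁻ i (w i) 0<ni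
      0<wj = normal>0⁻ j (w j) (subst (0ℤ <_) ni≡nj 0<ni)
  in i≢j (Finₚ.toℕ-injective (ℕₚ.suc-injective (ℤₚ.+-injective
       (trans (sym (normal-pos i 0<wi)) (trans ni≡nj (normal-pos j 0<wj))))))

module _ {n k} (A : Arrangement n k) where

  letter-fixed : ∀ {i} (p : π A ⟨$⟩ʳ i ≡ i) → letter A i ≡ fixedLetter i (φ A (i , p))
  letter-fixed {i} p with π A ⟨$⟩ʳ i Fin.≟ i
  ... | yes q = cong (λ r → fixedLetter i (φ A (i , r))) (Decidable⇒UIP.≡-irrelevant Fin._≟_ q p)
  ... | no ¬p = contradiction p ¬p

  letter-pos : ∀ {i} → 0ℤ < letter A i → letter A i ≡ + suc (toℕ (π A ⟨$⟩ʳ i))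
  letter-pos {i} 0<l with π A ⟨$⟩ʳ i Fin.≟ i
  ... | yes p = trans (fixedLetter-pos i (φ A (i , p)) 0<l) (cong (λ j → + suc (toℕ j)) (sym p))
  ... | no _  = refl

  letter-nonpos : ∀ {i} → ¬ 0ℤ < letter A i → π A ⟨$⟩ʳ i ≡ i
  letter-nonpos {i} 0≮l with π A ⟨$⟩ʳ i Fin.≟ i
  ... | yes p = p
  ... | no _  = contradiction (+<+ (s≤s z≤n)) 0≮l

  letter-Letter : ∀ i → Letter k (letter A i)
  letter-Letter i with π A ⟨$⟩ʳ i Fin.≟ i
  ... | yes p = fixedLetter-Letter i _
  ... | no _  = positive⇒Letter {k} (+<+ (s≤s z≤n))

  -- Reading the normal form along π gives the letters of `A`: a position with a nonpositive letter
  -- is fixed by π, so π permutes the remaining positions among themselves.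
  letter-normal : ∀ i → letter A i ≡ normal (π A ⟨$⟩ʳ i) (letter A (π A ⟨$⟩ʳ i))
  letter-normal i = go (0ℤ <? letter A i)
    where
    j = π A ⟨$⟩ʳ i
    go : Dec (0ℤ < letter A i) → letter A i ≡ normal j (letter A j)
    go (no 0≮i) = sym (trans (cong (λ h → normal h (letter A h)) (letter-nonpos 0≮i))
                             (normal-nonpos i 0≮i))
    go (yes 0<i) = go′ (0ℤ <? letter A j)
      where
      go′ : Dec (0ℤ < letter A j) → letter A i ≡ normal j (letter A j)
      go′ (yes 0<j) = trans (letter-pos 0<i) (sym (normal-pos j 0<j))
      -- A nonpositive letter at `j` makes `j` a fixed point; then `i` and `j` have the same image
      -- and coincide, although the letter at `i` is positive.
      go′ (no 0≮j)  = contradiction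
        (subst (λ h → 0ℤ < letter A h)
               (sym (permutation-injective (π A) (letter-nonpos 0≮j))) 0<i)
        0≮j

  letters-↭ : tabulate (letter A) ↭ normalForm (letter A)
  letters-↭ = begin
    tabulate (letter A)           ≡⟨ Listₚ.tabulate-cong letter-normal ⟩
    tabulate (U ∘ (π A ⟨$⟩ʳ_))    ≡⟨ Listₚ.map-tabulate (π A ⟨$⟩ʳ_) U ⟨
    map U (tabulate (π A ⟨$⟩ʳ_))  ↭⟨ ↭ₚ.map⁺ U (Injective⇒↭ (permutation-injective (π A))) ⟩
    map U (allFin n)              ≡⟨ Listₚ.map-tabulate (λ i → i) U ⟩
    tabulate U                    ∎
    where
    open PermutationReasoning
    U : Fin n → ℤ
    U j = normal j (letter A j)

  permForm-Standard : Standard k (permForm A)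
  permForm-Standard = standardise-Standard
    (Allₚ.tabulate⁺ letter-Letter)
    (PositivesDistinct-resp-↭ (↭-sym letters-↭) (normalForm-distinct (letter A)))

  length-permForm : length (permForm A) ≡ n
  length-permForm = trans (Listₚ.length-map (relabel w) w) (Listₚ.length-tabulate (letter A))
    where w = tabulate (letter A)

letter-injective : ∀ {n k} (A B : Arrangement n k) → (∀ i → letter A i ≡ letter B i) → A ≋ B
letter-injective A B eq = same-π , same-φ
  where
  same-π : ∀ i → π A ⟨$⟩ʳ i ≡ π B ⟨$⟩ʳ i
  same-π i with 0ℤ <? letter A i
  ... | yes 0<l = Finₚ.toℕ-injective (ℕₚ.suc-injective (ℤₚ.+-injective
    (trans (sym (letter-pos A 0<l)) (trans (eq i) (letter-pos B (subst (0ℤ <_) (eq i) 0<l))))))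
  ... | no 0≮l = trans (letter-nonpos A 0≮l)
    (sym (letter-nonpos B (0≮l ∘ subst (0ℤ <_) (sym (eq i)))))
  same-φ : ∀ x y → proj₁ x ≡ proj₁ y → φ A x ≡ φ B y
  same-φ (i , p) (.i , q) refl = fixedLetter-injective i
    (trans (sym (letter-fixed A p)) (trans (eq i) (letter-fixed B q)))

-- Standardisation keeps the `clamp` pattern, which determines the normal form and so the multiset
-- of original letters. Both words were therefore relabelled by the same map, and this map is
-- injective on their letters.
permForm-injective : ∀ {n k} (A B : Arrangement n k) → permForm A ≡ permForm B → A ≋ B
permForm-injective A B eq = letter-injective A B λ i →
  relabel-injective (∈ₚ.∈-tabulate⁺ i) (↭ₚ.∈-resp-↭ (↭-sym wA↭wB) (∈ₚ.∈-tabulate⁺ i))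
    (trans (relabelled i) (sym (relabel-↭ wA↭wB (letter B i))))
  where
  wA = tabulate (letter A)
  wB = tabulate (letter B)
  relabelled : ∀ i → relabel wA (letter A i) ≡ relabel wB (letter B i)
  relabelled = tabulate-injective (trans (sym (Listₚ.map-tabulate (letter A) (relabel wA)))
    (trans eq (Listₚ.map-tabulate (letter B) (relabel wB))))
  same-clamp : ∀ i → clamp (letter A i) ≡ clamp (letter B i)
  same-clamp i = trans (sym (clamp-relabel {wA} (∈ₚ.∈-tabulate⁺ i)))
    (trans (cong clamp (relabelled i)) (clamp-relabel {wB} (∈ₚ.∈-tabulate⁺ i)))
  wA↭wB : wA ↭ wB
  wA↭wB = ↭-trans (letters-↭ A) (↭-trans
    (↭-reflexive (Listₚ.tabulate-cong λ i → normal-cong i (letter A i) (letter B i) (same-clamp i)))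
    (↭-sym (letters-↭ B)))

-- Being a rearrangement of its normal form, `w` has as positive letters exactly the numbers of the
-- positions that carry one. Sending each such position to its letter and fixing all others gives π.
arrange : ∀ {n k} → k ≥ 1 → (w : Fin n → ℤ) → (∀ i → Letter k (w i)) →
  tabulate w ↭ normalForm w → ∃ λ (A : Arrangement n k) → ∀ i → letter A i ≡ w i
arrange {n} {k} k≥1 w letters w↭ = A , letter-A
  where
  distinct : ∀ {i j} → 0ℤ < w i → w i ≡ w j → i ≡ j
  distinct {i} {j} 0<wi eq with i Fin.≟ j
  ... | yes i≡j = i≡j
  ... | no i≢j  = contradiction eq (AllPairs-tabulate⁻ Apart-sym
    (PositivesDistinct-resp-↭ (↭-sym w↭) (normalForm-distinct w)) i≢j 0<wi)

  -- The conjunct `0ℤ < w j` keeps the two cases from sharing a target, as injectivity requires.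
  Target : Fin n → Fin n → Set
  Target i j = (0ℤ < w i × 0ℤ < w j × w i ≡ + suc (toℕ j)) ⊎ (¬ 0ℤ < w i × j ≡ i)

  target : ∀ i → ∃ (Target i)
  target i with 0ℤ <? w i
  ... | no 0≮wi  = i , inj₂ (0≮wi , refl)
  ... | yes 0<wi with j , eq ← ∈ₚ.∈-tabulate⁻ (↭ₚ.∈-resp-↭ w↭ (∈ₚ.∈-tabulate⁺ i)) =
    let 0<wj = normal>0⁻ j (w j) (subst (0ℤ <_) eq 0<wi)
    in j , inj₁ (0<wi , 0<wj , trans eq (normal-pos j 0<wj))

  Target-injective : ∀ {i i′ j} → Target i j → Target i′ j → i ≡ i′
  Target-injective (inj₁ (0<wi , _ , eq)) (inj₁ (_ , _ , eq′))  = distinct 0<wi (trans eq (sym eq′))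
  Target-injective (inj₁ (_ , 0<wj , _))  (inj₂ (0≮wi′ , refl)) = contradiction 0<wj 0≮wi′
  Target-injective (inj₂ (0≮wi , refl))   (inj₁ (_ , 0<wj , _)) = contradiction 0<wj 0≮wi
  Target-injective (inj₂ (_ , refl))      (inj₂ (_ , refl))     = refl

  σ = injective⇒permutation (proj₁ ∘ target) λ {i} {i′} eq →
    Target-injective (proj₂ (target i)) (subst (Target i′) (sym eq) (proj₂ (target i′)))

  target-σ : ∀ i → Target i (proj₁ σ ⟨$⟩ʳ i)
  target-σ i = subst (Target i) (sym (proj₂ σ i)) (proj₂ (target i))

  colour : ∀ i → proj₁ σ ⟨$⟩ʳ i ≡ i → ∃ λ (c : Fin k) → fixedLetter i c ≡ w i
  colour i p = fixedLetter-surjective i k≥1 (letters i) (pos (target-σ i))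
    where
    pos : Target i (proj₁ σ ⟨$⟩ʳ i) → 0ℤ < w i → w i ≡ + suc (toℕ i)
    pos (inj₁ (_ , _ , eq)) _    = trans eq (cong (λ j → + suc (toℕ j)) p)
    pos (inj₂ (0≮wi , _))   0<wi = contradiction 0<wi 0≮wi

  A : Arrangement n k
  A = proj₁ σ , λ (i , p) → proj₁ (colour i p)

  letter-A : ∀ i → letter A i ≡ w i
  letter-A i with proj₁ σ ⟨$⟩ʳ i Fin.≟ i | target-σ i
  ... | yes p | _                    = proj₂ (colour i p)
  ... | no _  | inj₁ (_ , _ , eq)    = sym eq
  ... | no ¬p | inj₂ (_ , p)         = contradiction p ¬p

untabulate : ∀ {A : Set} {n} (xs : List A) → length xs ≡ n → ∃ λ (f : Fin n → A) → tabulate f ≡ xs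
untabulate xs refl = lookup xs , Listₚ.tabulate-lookup xs

normal-Letter : ∀ {n k} (i : Fin n) {x} → Letter k x → Letter k (normal i x)
normal-Letter {k = k} i {x} l with 0ℤ <? x
... | yes _ = positive⇒Letter {k} (+<+ (s≤s z≤n))
... | no _  = l

normalForm-Letter : ∀ {n k} (w : Fin n → ℤ) → All (Letter k) (tabulate w) →
  All (Letter k) (normalForm w)
normalForm-Letter {k = k} w letters =
  Allₚ.tabulate⁺ λ i → normal-Letter {k = k} i (Allₚ.tabulate⁻ letters i)

clamp-standardise : ∀ w → map clamp (standardise w) ≡ map clamp w
clamp-standardise w = trans (sym (Listₚ.map-∘ w))
  (Listₚ.map-cong-local (All.tabulate clamp-relabel))

clamp-normalForm : ∀ {n} (w : Fin n → ℤ) → map clamp (normalForm w) ≡ map clamp (tabulate w)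
clamp-normalForm w = trans (Listₚ.map-tabulate _ clamp)
  (trans (Listₚ.tabulate-cong (λ i → clamp-normal i (w i))) (sym (Listₚ.map-tabulate w clamp)))

-- Since `W` relabels to `V` position by position, both have the same `clamp` pattern and the same
-- normal form. So `W` rearranges its own normal form, as `arrange` demands.
realise : ∀ {n k} → k ≥ 1 → (V W : Fin n → ℤ) → Standard k (tabulate V) →
  normalForm V ↭ tabulate W → tabulate V ≡ map (relabel (normalForm V)) (tabulate W) →
  ∃ λ (A : Arrangement n k) → permForm A ≡ tabulate V
realise {n} {k} k≥1 V W (standard , _) u↭w v≡ = A , (begin
  permForm A                       ≡⟨ cong standardise (Listₚ.tabulate-cong letter-A) ⟩
  standardise (tabulate W)         ≡⟨ Listₚ.map-cong (relabel-↭ (↭-sym u↭w)) (tabulate W) ⟩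
  map (relabel u) (tabulate W)     ≡⟨ v≡ ⟨
  tabulate V                       ∎)
  where
  open ≡-Reasoning
  u = normalForm V
  letters : All (Letter k) (tabulate W)
  letters = ↭ₚ.All-resp-↭ u↭w (normalForm-Letter V (All.map proj₂ standard))
  same-clamp : ∀ i → clamp (V i) ≡ clamp (W i)
  same-clamp i = trans
    (cong clamp (tabulate-injective (trans v≡ (Listₚ.map-tabulate W (relabel u))) i))
    (clamp-relabel (↭ₚ.∈-resp-↭ (↭-sym u↭w) (∈ₚ.∈-tabulate⁺ i)))
  arranged : ∃ λ (A : Arrangement n k) → ∀ i → letter A i ≡ W i
  arranged = arrange k≥1 W (Allₚ.tabulate⁻ letters)
    (↭-trans (↭-sym u↭w) (↭-reflexive
      (Listₚ.tabulate-cong λ i → normal-cong i (V i) (W i) (same-clamp i))))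
  A = proj₁ arranged
  letter-A = proj₂ arranged

-- The normal form u of v has a standardisation ↭ v, so v is the standardisation
-- of some rearrangement of u.
permForm-surjective : ∀ {n k} → k ≥ 1 → ∀ v → length v ≡ n → Standard k v →
  ∃ λ (A : Arrangement n k) → permForm A ≡ v
permForm-surjective {n} {k} k≥1 v len sv with V , refl ← untabulate v len =
  let su = standardise-Standard {k} (normalForm-Letter V (All.map proj₂ (proj₁ sv)))
             (normalForm-distinct V)
      same = trans (clamp-standardise (normalForm V)) (clamp-normalForm V)
      w , v≡ , u↭w = ↭ₚ.↭-map-inv (relabel (normalForm V)) (Standard-↭ su sv same)
      W , w≡ = untabulate w (trans (sym (↭ₚ.↭-length u↭w)) (Listₚ.length-tabulate _))
  in realise k≥1 V W sv (↭-trans u↭w (↭-reflexive (sym w≡)))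
       (trans v≡ (cong (map (relabel (normalForm V))) (sym w≡)))

-- Enumeration of the standard words

lookup-injective : ∀ {A : Set} {xs : List A} → Unique xs → ∀ {i j} →
  lookup xs i ≡ lookup xs j → i ≡ j
lookup-injective {xs = xs} xs! {i} {j} eq with i Fin.≟ j
... | yes i≡j = i≡j
... | no i≢j  = contradiction eq
  (AllPairs-tabulate⁻ ≢-sym (subst Unique (sym (Listₚ.tabulate-lookup xs)) xs!) i≢j)

words : ∀ {A : Set} → List A → ℕ → List (List A)
words as zero    = [ [] ]
words as (suc n) = cartesianProductWith _∷_ as (words as n)

∈-words⁺ : ∀ {A : Set} {as w : List A} → All (_∈ as) w → w ∈ words as (length w)
∈-words⁺ []            = here refl
∈-words⁺ (a∈as ∷ w⊆as) = ∈ₚ.∈-cartesianProductWith⁺ _∷_ a∈as (∈-words⁺ w⊆as)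

∈-words⁻ : ∀ {A : Set} (as : List A) n {w} → w ∈ words as n → length w ≡ n
∈-words⁻ as zero    (here refl) = refl
∈-words⁻ as (suc n) w∈
  with _ , _ , _ , w′∈ , refl ← ∈ₚ.∈-cartesianProductWith⁻ _∷_ as (words as n) w∈ =
  cong suc (∈-words⁻ as n w′∈)

-- Only a finite superset of the letters, cut down by the filter in `standardWords`. For positive
-- `k` zero occurs twice, which the deduplication there absorbs.
alphabet : ℕ → ℕ → List ℤ
alphabet n k = map +_ (upTo (suc n)) ++ map (-_ ∘ +_) (upTo k)

_≟ʷ_ : DecidableEquality (List ℤ)
_≟ʷ_ = Listₚ.≡-dec _≟_

standardWords : ℕ → ℕ → List (List ℤ)
standardWords n k = deduplicate _≟ʷ_ (filter (standard? k) (words (alphabet n k) n))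

standardWords-! : ∀ n k → Unique (standardWords n k)
standardWords-! n k = DecUniqueₚ.deduplicate-! _≟ʷ_ _

∈-standardWords⁻ : ∀ n k {w} → w ∈ standardWords n k → length w ≡ n × Standard k w
∈-standardWords⁻ n k w∈
  with w∈words , s ← ∈ₚ.∈-filter⁻ (standard? k) {xs = words (alphabet n k) n}
                       (∈ₚ.∈-deduplicate⁻ _≟ʷ_ _ w∈) =
  ∈-words⁻ (alphabet n k) n w∈words , s

Standard⇒∈-alphabet : ∀ {k w} → Standard k w → ∀ {x} → x ∈ w → x ∈ alphabet (length w) k
Standard⇒∈-alphabet {k} {w} (fixed , _) { + x} x∈w =
  ∈ₚ.∈-++⁺ˡ (∈ₚ.∈-map⁺ +_ (∈ₚ.∈-upTo⁺ (s≤s (bound x x∈w))))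
  where
  bound : ∀ x → + x ∈ w → x ℕ.≤ length w
  bound zero    _   = z≤n
  bound (suc x) x∈w = subst (ℕ._≤ length w)
    (ℤₚ.+-injective (trans (sym (relabel-pos w (+<+ (s≤s z≤n)))) (proj₁ (All.lookup fixed x∈w))))
    (Listₚ.length-filter (upto? (+ suc x)) w)
Standard⇒∈-alphabet {k} {w} (fixed , _) { -[1+ x ]} x∈w =
  ∈ₚ.∈-++⁺ʳ _ (∈ₚ.∈-map⁺ (-_ ∘ +_) (∈ₚ.∈-upTo⁺
    (ℤₚ.drop‿+<+ (ℤₚ.neg-cancel-< {+ k} {+ suc x} (proj₁ (proj₂ (All.lookup fixed x∈w)))))))

∈-standardWords⁺ : ∀ {k w} → Standard k w → w ∈ standardWords (length w) k
∈-standardWords⁺ {k} s = ∈ₚ.∈-deduplicate⁺ _≟ʷ_ (∈ₚ.∈-filter⁺ (standard? k)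
  (∈-words⁺ (All.tabulate (Standard⇒∈-alphabet s))) s)

hasValue? : (f : List ℤ → ℕ) (v : ℕ) → ∀ w → Dec (f w ≡ v)
hasValue? f v w = f w ℕ.≟ v

-- `permForm` is a bijection from the fibre to the standard words of length `n` with value `v`; the
-- index in their repetition-free list numbers them.
fibre-cardinality : ∀ {n k} → k ≥ 1 → ∀ f v →
  HasCardinality (Fibre (𝖠 n k) (onPermForm f n k) v)
                 (count (hasValue? f v) (standardWords n k))
fibre-cardinality {n} {k} k≥1 f v = record
  { to        = λ (A , e) → index (member A e)
  ; from      = λ i → proj₁ (arrangement i) ,
                      trans (cong f (proj₂ (arrangement i))) (proj₂ (standard i))
  ; to-cong   = λ {(A , e)} {(B , e′)} A≋B → lookup-injective L!
                  (trans (lookup-member A e) (trans (permForm-cong A≋B) (sym (lookup-member B e′))))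
  ; from-cong = λ { refl → ≋-refl }
  ; inverse   = (λ {i} {(A , e)} A≋ → lookup-injective L!
                  (trans (lookup-member A e) (trans (permForm-cong A≋) (proj₂ (arrangement i)))))
              , (λ { {(A , e)} refl → permForm-injective _ A
                  (trans (proj₂ (arrangement (index (member A e)))) (lookup-member A e)) })
  }
  where
  L = filter (hasValue? f v) (standardWords n k)
  L! : Unique L
  L! = Uniqueₚ.filter⁺ (hasValue? f v) (standardWords-! n k)
  member : (A : Arrangement n k) → f (permForm A) ≡ v → permForm A ∈ L
  member A e = ∈ₚ.∈-filter⁺ (hasValue? f v)
    (subst (λ m → permForm A ∈ standardWords m k) (length-permForm A)
      (∈-standardWords⁺ (permForm-Standard A))) e
  lookup-member : ∀ A e → lookup L (index (member A e)) ≡ permForm A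
  lookup-member A e = sym (Anyₚ.lookup-index (member A e))
  standard : ∀ i → lookup L i ∈ standardWords n k × f (lookup L i) ≡ v
  standard i = ∈ₚ.∈-filter⁻ (hasValue? f v) {xs = standardWords n k} (∈ₚ.∈-lookup i)
  arrangement : ∀ i → ∃ λ (A : Arrangement n k) → permForm A ≡ lookup L i
  arrangement i = let len , s = ∈-standardWords⁻ n k (proj₁ (standard i))
                  in permForm-surjective k≥1 (lookup L i) len s

-- Equidistribution from injective rearrangements.

rearrangement⇒Equidistributed : ∀ {n k} → k ≥ 1 →
  (f g : List ℤ → ℕ) (Φ : List ℤ → List ℤ) →
  (∀ w → Φ w ↭ w) → (∀ {u v} → Φ u ≡ Φ v → u ≡ v) → (∀ w → f (Φ w) ≡ g w) →
  Equidistributed (𝖠 n k) (onPermForm f n k) (onPermForm g n k)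
rearrangement⇒Equidistributed {n} {k} k≥1 f g Φ Φ-↭ Φ-inj f∘Φ≗g v =
  count (hasValue? f v) W , fibre-cardinality k≥1 f v ,
  subst (HasCardinality _) (sym same-count) (fibre-cardinality k≥1 g v)
  where
  open ≡-Reasoning
  W = standardWords n k
  Φ-closed : ∀ {w} → w ∈ map Φ W → w ∈ W
  Φ-closed w∈ with u , u∈ , refl ← ∈ₚ.∈-map⁻ Φ w∈ =
    let len , s = ∈-standardWords⁻ n k u∈
    in subst (λ m → Φ u ∈ standardWords m k) (trans (↭ₚ.↭-length (Φ-↭ u)) len)
         (∈-standardWords⁺ (Standard-resp-↭ (↭-sym (Φ-↭ u)) s))
  -- Rearranging preserves standardness, so Φ maps the finite list into itself and, being injective,
  -- permutes it.
  ΦW↭W : map Φ W ↭ W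
  ΦW↭W = Unique⊆⇒↭ (Uniqueₚ.map⁺ Φ-inj (standardWords-! n k)) Φ-closed
    (ℕₚ.≤-reflexive (sym (Listₚ.length-map Φ W)))
  same-count : count (hasValue? f v) W ≡ count (hasValue? g v) W
  same-count = begin
    count (hasValue? f v) W          ≡⟨ count-↭ (hasValue? f v) ΦW↭W ⟨
    count (hasValue? f v) (map Φ W)  ≡⟨ count-map (hasValue? g v) (hasValue? f v) Φ W
                                          (All.tabulate λ {w} _ →
                                            trans (sym (f∘Φ≗g w)) , trans (f∘Φ≗g w)) ⟩
    count (hasValue? g v) W          ∎

proposition5 : (n k : ℕ) → k ≥ 1 →
    Equidistributed (𝖠 n k) (onPermForm exc n k) (onPermForm des n k)
    × Equidistributed (𝖠 n k) (onPermForm inv n k) (onPermForm maj n k)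
proposition5 n k k≥1 =
  rearrangement⇒Equidistributed k≥1 exc des (foata₁ ∘ reverse)
    (λ w → ↭-trans (foata₁-↭ (reverse w)) (↭ₚ.↭-reverse w))
    (λ eq → Listₚ.reverse-injective (foata₁-injective _ _ eq))
    (λ w → trans (exc-foata₁ (reverse w)) (cong des (Listₚ.reverse-involutive w))) ,
  -- `foata₂` returns a reversed word, so a second reversal is needed; the bottom row given by
  -- `foata₁` is already in reading order.
  rearrangement⇒Equidistributed k≥1 inv maj (reverse ∘ foata₂ ∘ reverse)
    (λ w → ↭-trans (↭ₚ.↭-reverse _) (↭-trans (foata₂-↭ (reverse w)) (↭ₚ.↭-reverse w)))
    (λ eq → Listₚ.reverse-injective (foata₂-injective _ _ (Listₚ.reverse-injective eq)))
    (λ w → trans (inv-foata₂ (reverse w)) (cong maj (Listₚ.reverse-involutive w)))
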